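{- Let $a,b,c$ be indeterminates and define $G_n(a,b,c)$ by the formal power series identity $$\sum_{n\ge0}G_n(a,b,c)z^n=1+\sum_{n\ge1}z^n\prod_{k=0}^{n-1}\frac{a+bk}{1-c(k+1)z}.$$ Let $\alpha_{2n}=a+nb$ and $\alpha_{2n+1}=(c+b)(n+1)$ for $n\ge0$, and $\alpha_{ -1}=0$. Then $$\sum_{n\ge0}G_n(a,b,c)z^n=\cfrac{1}{1-\cfrac{\alpha_0z}{1-\cfrac{\alpha_1z}{1-\cdots}}}=\cfrac{1}{1-(\alpha_{ -1}+\alpha_0)z-\cfrac{\alpha_0\alpha_1z^2}{1-(\alpha_1+\alpha_2)z-\cfrac{\alpha_2\alpha_3z^2}{1-\cdots}}},$$ and $(G_n(a,b,c))_{n\ge0}$ is an $\mathbf{x}$-Stieltjes moment sequence and is $3$-$\mathbf{x}$-log-convex, where $\mathbf{x}=(a,b,c)$.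
   Context: A matrix is $\mathbf{x}$-TP if all its minors are polynomials in $\mathbf{x}$ with nonnegative coefficients; a sequence is an $\mathbf{x}$-Stieltjes moment sequence if its Hankel matrix $[\alpha_{i+j}]_{i,j\ge0}$ is $\mathbf{x}$-TP. Define $\mathcal{L}[\alpha_i]=\alpha_{i-1}\alpha_{i+1}-\alpha_i^2$ ($i\ge1$), $\mathcal{L}^m=\mathcal{L}(\mathcal{L}^{m-1})$; a sequence is $3$-$\mathbf{x}$-log-convex if $\mathcal{L}^m$ of it has nonnegative coefficients for $m\le3$ wherever defined. -}

module Defs where

open import Data.Nat as ℕ using (ℕ; zero; suc; _∸_; _+_; _*_)
open import Data.Nat.DivMod using (_/_; _%_)
open import Data.Integer as ℤ using (ℤ; +_; 0ℤ; 1ℤ)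
open import Data.Fin as Fin using (Fin; zero; suc; toℕ; punchIn)
open import Data.Product using (Σ; ∃; _×_; _,_)
open import Relation.Binary.PropositionalEquality using (_≡_)

-- Coefficient ring: formal power series in the indeterminates a, b, c
-- over ℤ, represented by coefficient functions:  f i j l = [a^i b^j c^l] f.
-- (All objects below that the paper calls polynomials are elements of
-- this ring; "is a polynomial" is asserted explicitly via finite support.)

P : Set
P = ℕ → ℕ → ℕ → ℤ

sumTo : ℕ → (ℕ → ℤ) → ℤ
sumTo zero    f = f 0
sumTo (suc n) f = sumTo n f ℤ.+ f (suc n)

sumP : ℕ → (ℕ → P) → P
sumP n f i j l = sumTo n (λ t → f t i j l)

0P : P
0P _ _ _ = 0ℤ

1P : P
1P zero zero zero = 1ℤ
1P _    _    _    = 0ℤ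

varA : P
varA (suc zero) zero zero = 1ℤ
varA _          _    _    = 0ℤ

varB : P
varB zero (suc zero) zero = 1ℤ
varB _    _          _    = 0ℤ

varC : P
varC zero zero (suc zero) = 1ℤ
varC _    _    _          = 0ℤ

infixl 6 _+P_ _-P_
infixl 7 _*P_ _·P_

_+P_ : P → P → P
(f +P g) i j l = f i j l ℤ.+ g i j l

-P_ : P → P
(-P f) i j l = ℤ.- f i j l

_-P_ : P → P → P
f -P g = f +P (-P g)

_·P_ : ℤ → P → P
(k ·P f) i j l = k ℤ.* f i j l

_*P_ : P → P → P
(f *P g) i j l =
  sumTo i (λ i₁ → sumTo j (λ j₁ → sumTo l (λ l₁ →
    f i₁ j₁ l₁ ℤ.* g (i ∸ i₁) (j ∸ j₁) (l ∸ l₁))))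

natP : ℕ → P
natP n = (+ n) ·P 1P

_≈P_ : P → P → Set
f ≈P g = ∀ i j l → f i j l ≡ g i j l

PolyNonneg : P → Set
PolyNonneg f =
  (∃ λ D → ∀ i j l → D ℕ.< i + j + l → f i j l ≡ 0ℤ)
  × (∀ i j l → 0ℤ ℤ.≤ f i j l)

-- Formal power series in z with coefficients in P:  F m = [z^m] F.

Ser : Set
Ser = ℕ → P

infixl 6 _+S_
infixl 7 _*S_

_+S_ : Ser → Ser → Ser
(F +S G) m = F m +P G m

_*S_ : Ser → Ser → Ser
(F *S G) m = sumP m (λ t → F t *P G (m ∸ t))

constS : P → Ser
constS p zero    = p
constS p (suc _) = 0P

1S : Ser
1S = constS 1P

zS : Ser
zS (suc zero) = 1P
zS _          = 0P

zTimes : Ser → Ser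
zTimes F zero    = 0P
zTimes F (suc m) = F m

powS : Ser → ℕ → Ser
powS F zero    = 1S
powS F (suc k) = powS F k *S F

prodS : ℕ → (ℕ → Ser) → Ser
prodS zero    F = 1S
prodS (suc n) F = prodS n F *S F n

-- The inverse 1/(1 - z H) = Σ_{k≥0} (z H)^k (only k ≤ m contributes to z^m).
invOneMinusZ : Ser → Ser
invOneMinusZ H m = sumP m (λ k → powS (zTimes H) k m)

GFactor : ℕ → Ser
GFactor k = constS (varA +P natP k *P varB)
            *S invOneMinusZ (constS (natP (suc k) *P varC))

GTerm : ℕ → Ser
GTerm n = powS zS n *S prodS n GFactor

-- only the terms n = 1 .. m+1 can contribute to z^m (term n is O(z^n))
GSeries : Ser
GSeries m = 1S m +P sumP m (λ n → GTerm (suc n) m)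

G : ℕ → P
G n = GSeries n

alpha : ℕ → P
alpha k with k % 2
... | zero  = varA +P natP (k / 2) *P varB
... | suc _ = natP (suc (k / 2)) *P (varC +P varB)

alphaM1 : ℕ → P
alphaM1 zero    = 0P
alphaM1 (suc k) = alpha k

sfrac : ℕ → ℕ → Ser
sfrac zero    j = 1S
sfrac (suc N) j = invOneMinusZ (constS (alpha j) *S sfrac N (suc j))

jgam : ℕ → P
jgam j = alphaM1 (2 * j) +P alpha (2 * j)

jdel : ℕ → P
jdel j = alpha (2 * j) *P alpha (suc (2 * j))

-- Convergents of 1/(1 - γ_j z - δ_j z² /(1 - γ_{j+1} z - ...)),
-- truncated after N levels; 1 - γ z - δ z² T = 1 - z (γ + z δ T).
jfrac : ℕ → ℕ → Ser
jfrac zero    j = 1S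
jfrac (suc N) j =
  invOneMinusZ (constS (jgam j) +S zTimes (constS (jdel j) *S jfrac N (suc j)))

ConvergesTo : (ℕ → Ser) → Ser → Set
ConvergesTo C F = ∀ m → ∃ λ N₀ → ∀ N → N₀ ℕ.≤ N → C N m ≈P F m

sumFinP : (k : ℕ) → (Fin k → P) → P
sumFinP zero    f = 0P
sumFinP (suc k) f = f zero +P sumFinP k (λ i → f (suc i))

sign : ℕ → ℤ
sign zero    = 1ℤ
sign (suc n) = ℤ.- sign n

det : (k : ℕ) → (Fin k → Fin k → P) → P
det zero    M = 1P
det (suc k) M = sumFinP (suc k) (λ j →
  sign (toℕ j) ·P (M zero j *P det k (λ r c → M (suc r) (punchIn j c))))

StrictlyIncreasing : {k : ℕ} → (Fin k → ℕ) → Set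
StrictlyIncreasing {k} r = ∀ (i j : Fin k) → i Fin.< j → r i ℕ.< r j

IsxTP : (ℕ → ℕ → P) → Set
IsxTP M = ∀ (k : ℕ) (r c : Fin k → ℕ) →
  StrictlyIncreasing r → StrictlyIncreasing c →
  PolyNonneg (det k (λ i j → M (r i) (c j)))

IsxStieltjes : (ℕ → P) → Set
IsxStieltjes s = IsxTP (λ i j → s (i + j))

-- The operator L, reindexed from 0:  Lop s i = L[s]_{i+1}
--   = s_i s_{i+2} - s_{i+1}^2; so iterL m s i = L^m[s]_{i+m}.

Lop : (ℕ → P) → (ℕ → P)
Lop s i = s i *P s (suc (suc i)) -P s (suc i) *P s (suc i)

iterL : ℕ → (ℕ → P) → (ℕ → P)
iterL zero    s = s
iterL (suc m) s = Lop (iterL m s)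

Is3xLogConvex : (ℕ → P) → Set
Is3xLogConvex s = ∀ m → 1 ℕ.≤ m → m ℕ.≤ 3 → ∀ i → PolyNonneg (iterL m s i)

{-# OPTIONS --safe #-}
-- Put e k = a + k b and o k = (k + 1)(c + b), so that α = e 0, o 0, e 1, o 1, ….
-- All claims are read off the tableau L n k of weighted Dyck path sums with
-- these weights.
--
-- The closed form L n k = Σₘ S(n, m) c^(n−m) binom(m, k) ∏_{k ≤ i < m} (a + i b)
-- satisfies the recurrence of L and gives L n 0 = Gₙ.  The columns of the tableau
-- solve the three-term recurrences of the two continued fractions, so the tails
-- are quotients of consecutive columns (Euler's method).
--
-- For total positivity, the Hankel matrix is reached from the tableau by row
-- operations in which each new row is a nonnegative combination of two old rows,
-- with interlacing positions; by multilinearity such operations preserve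
-- nonnegativity of all minors.
--
-- Finally 𝓛(s), 𝓛²(s) and 𝓛³(s) are, by Dodgson condensation, polynomials with
-- nonnegative coefficients in the contiguous Hankel minors of s of order ≤ 4.
module Submission where

open import Algebra.Bundles using (CommutativeRing)
open import Algebra.Solver.Ring.AlmostCommutativeRing
  using (fromCommutativeRing; _-Raw-AlmostCommutative⟶_)
import Algebra.Solver.Ring
open import Data.Empty using (⊥-elim)
open import Data.Fin as Fin using (Fin; zero; suc; toℕ; inject₁; punchIn)
open import Data.Integer as ℤ using (ℤ; +_; 0ℤ; 1ℤ)
import Data.Integer.Properties as ℤₚ
open import Data.Maybe using (Maybe; map)
open import Data.Nat as ℕ using (ℕ; zero; suc; pred; _∸_; z≤n; s≤s)
open import Data.Nat.DivMod using (_/_; _%_; m/n≡1+[m∸n]/n)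
import Data.Nat.Properties as ℕₚ
open import Data.Nat.Solver using (module +-*-Solver)
open import Data.Product using (_,_; ∃; ∃₂; _×_; proj₁; proj₂)
open import Data.Sum using (_⊎_; inj₁; inj₂)
open import Data.Vec.Functional using (_∷_)
open import Level using (0ℓ)
open import Relation.Binary.Consequences using (dec⇒weaklyDec)
open import Relation.Binary.PropositionalEquality as ≡ using (_≡_; _≢_)
open import Relation.Nullary using (yes; no)
open import Defs using (StrictlyIncreasing)

-- Power series over a commutative ring

-- A full step of the tableau, from `L n` to `L (suc n)`, combines three neighbouring heights, and
-- such a combination can spoil the sign of a minor even if its weights are nonnegative. The half
-- step through `L′` factors it into two bidiagonal steps, one with weights 1 and `o k`, the other
-- with weights 1 and `e k`. This factorisation is what the weights α carry beyond the coefficients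
-- of the J-fraction. A second obstacle is that column 0 of the tableau satisfies no recurrence of
-- its own: its next entry involves column 1. Hence the closed form covers all columns `k`. Its
-- factor binom(m, k) provides a relation between columns k and k + 1 that trades multiples of k for
-- multiples of m. After this trade the part with c is exactly the term c m of the Stirling
-- recurrence, and the part with b belongs to the next factor of the product.

record Summation (R : CommutativeRing 0ℓ 0ℓ) : Set where
  open CommutativeRing R
  field
    Σ : ℕ → (ℕ → Carrier) → Carrier
    Σ-zero : ∀ f → Σ 0 f ≈ f 0
    Σ-suc : ∀ n f → Σ (suc n) f ≈ Σ n f + f (suc n)

record UnitSeries (R : CommutativeRing 0ℓ 0ℓ) : Set where
  open CommutativeRing R
  field
    𝟙 : ℕ → Carrier
    𝟙-zero : 𝟙 0 ≈ 1#
    𝟙-suc : ∀ n → 𝟙 (suc n) ≈ 0#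

module FiniteSums (R : CommutativeRing 0ℓ 0ℓ) (S : Summation R) where

  open CommutativeRing R
  open Summation S
  open import Algebra.Properties.CommutativeSemigroup +-commutativeSemigroup
    using (interchange)
  open import Relation.Binary.Reasoning.Setoid setoid

  Σ-cong-≤ : ∀ n {f g} → (∀ t → t ℕ.≤ n → f t ≈ g t) → Σ n f ≈ Σ n g
  Σ-cong-≤ zero {f} {g} f≈g = begin
    Σ 0 f  ≈⟨ Σ-zero f ⟩
    f 0    ≈⟨ f≈g 0 z≤n ⟩
    g 0    ≈⟨ Σ-zero g ⟨
    Σ 0 g  ∎
  Σ-cong-≤ (suc n) {f} {g} f≈g = begin
    Σ (suc n) f        ≈⟨ Σ-suc n f ⟩
    Σ n f + f (suc n)  ≈⟨ +-cong (Σ-cong-≤ n λ t t≤n → f≈g t (ℕₚ.m≤n⇒m≤1+n t≤n)) (f≈g _ ℕₚ.≤-refl) ⟩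
    Σ n g + g (suc n)  ≈⟨ Σ-suc n g ⟨
    Σ (suc n) g        ∎

  Σ-cong : ∀ n {f g} → (∀ t → f t ≈ g t) → Σ n f ≈ Σ n g
  Σ-cong n f≈g = Σ-cong-≤ n λ t _ → f≈g t

  Σ-0 : ∀ n {f} → (∀ t → t ℕ.≤ n → f t ≈ 0#) → Σ n f ≈ 0#
  Σ-0 zero {f} f≈0 = trans (Σ-zero f) (f≈0 0 z≤n)
  Σ-0 (suc n) {f} f≈0 = begin
    Σ (suc n) f        ≈⟨ Σ-suc n f ⟩
    Σ n f + f (suc n)  ≈⟨ +-cong (Σ-0 n λ t t≤n → f≈0 t (ℕₚ.m≤n⇒m≤1+n t≤n)) (f≈0 _ ℕₚ.≤-refl) ⟩
    0# + 0#            ≈⟨ +-identityˡ 0# ⟩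
    0#                 ∎

  Σ-+ : ∀ n f g → Σ n (λ t → f t + g t) ≈ Σ n f + Σ n g
  Σ-+ zero f g = trans (Σ-zero _) (sym (+-cong (Σ-zero f) (Σ-zero g)))
  Σ-+ (suc n) f g = begin
    Σ (suc n) (λ t → f t + g t)                      ≈⟨ Σ-suc n _ ⟩
    Σ n (λ t → f t + g t) + (f (suc n) + g (suc n))  ≈⟨ +-congʳ (Σ-+ n f g) ⟩
    (Σ n f + Σ n g) + (f (suc n) + g (suc n))        ≈⟨ interchange _ _ _ _ ⟩
    (Σ n f + f (suc n)) + (Σ n g + g (suc n))        ≈⟨ +-cong (Σ-suc n f) (Σ-suc n g) ⟨
    Σ (suc n) f + Σ (suc n) g                        ∎

  Σ-*ˡ : ∀ n x f → Σ n (λ t → x * f t) ≈ x * Σ n f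
  Σ-*ˡ zero x f = trans (Σ-zero _) (*-congˡ (sym (Σ-zero f)))
  Σ-*ˡ (suc n) x f = begin
    Σ (suc n) (λ t → x * f t)              ≈⟨ Σ-suc n _ ⟩
    Σ n (λ t → x * f t) + x * f (suc n)    ≈⟨ +-congʳ (Σ-*ˡ n x f) ⟩
    x * Σ n f + x * f (suc n)              ≈⟨ distribˡ x _ _ ⟨
    x * (Σ n f + f (suc n))                ≈⟨ *-congˡ (Σ-suc n f) ⟨
    x * Σ (suc n) f                        ∎

  Σ-head : ∀ n f → Σ (suc n) f ≈ f 0 + Σ n (λ t → f (suc t))
  Σ-head zero f = trans (Σ-suc 0 f) (+-cong (Σ-zero f) (sym (Σ-zero _)))
  Σ-head (suc n) f = begin
    Σ (suc (suc n)) f                                    ≈⟨ Σ-suc (suc n) f ⟩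
    Σ (suc n) f + f (suc (suc n))                        ≈⟨ +-congʳ (Σ-head n f) ⟩
    f 0 + Σ n (λ t → f (suc t)) + f (suc (suc n))        ≈⟨ +-assoc _ _ _ ⟩
    f 0 + (Σ n (λ t → f (suc t)) + f (suc (suc n)))      ≈⟨ +-congˡ (Σ-suc n _) ⟨
    f 0 + Σ (suc n) (λ t → f (suc t))                    ∎

-- The summation operator and the unit series are parameters so that iterating
-- the construction reproduces the coefficientwise operations on P and Ser
-- up to definitional equality.
module PowerSeries (R : CommutativeRing 0ℓ 0ℓ) (S : Summation R) (U : UnitSeries R) where

  open CommutativeRing R
  open Summation S
  open UnitSeries U
  open FiniteSums R S
  open import Relation.Binary.Reasoning.Setoid setoid

  Series : Set
  Series = ℕ → Carrier

  infix 4 _≋_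
  -- A record instead of a bare function type, so that both series can be inferred from a proof of
  -- their equality.
  record _≋_ (f g : Series) : Set where
    constructor ptwise
    field at : ∀ n → f n ≈ g n
  open _≋_ public

  infixl 7 _⊛_
  _⊛_ : Series → Series → Series
  (f ⊛ g) n = Σ n λ t → f t * g (n ∸ t)

  shift : Series → Series
  shift f n = f (suc n)

  ⊛-zero : ∀ f g → (f ⊛ g) 0 ≈ f 0 * g 0
  ⊛-zero f g = Σ-zero _

  ⊛-head : ∀ f g n → (f ⊛ g) (suc n) ≈ f 0 * g (suc n) + (shift f ⊛ g) n
  ⊛-head f g n = Σ-head n _

  ⊛-last : ∀ f g n → (f ⊛ g) (suc n) ≈ (f ⊛ shift g) n + f (suc n) * g 0
  ⊛-last f g n = begin
    (f ⊛ g) (suc n)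
      ≈⟨ Σ-suc n _ ⟩
    Σ n (λ t → f t * g (suc n ∸ t)) + f (suc n) * g (n ∸ n)
      ≈⟨ +-cong
           (Σ-cong-≤ n λ t t≤n → *-congˡ (reflexive (≡.cong g (ℕₚ.+-∸-assoc 1 t≤n))))
           (*-congˡ (reflexive (≡.cong g (ℕₚ.n∸n≡0 n)))) ⟩
    (f ⊛ shift g) n + f (suc n) * g 0
      ∎

  ⊛-cong : ∀ {f f′ g g′} → f ≋ f′ → g ≋ g′ → f ⊛ g ≋ f′ ⊛ g′
  ⊛-cong p q .at n = Σ-cong n λ t → *-cong (p .at t) (q .at (n ∸ t))

  ⊛-comm : ∀ f g n → (f ⊛ g) n ≈ (g ⊛ f) n
  ⊛-comm f g zero = trans (⊛-zero f g) (trans (*-comm _ _) (sym (⊛-zero g f)))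
  ⊛-comm f g (suc n) = begin
    (f ⊛ g) (suc n)                      ≈⟨ ⊛-head f g n ⟩
    f 0 * g (suc n) + (shift f ⊛ g) n    ≈⟨ +-cong (*-comm _ _) (⊛-comm (shift f) g n) ⟩
    g (suc n) * f 0 + (g ⊛ shift f) n    ≈⟨ +-comm _ _ ⟩
    (g ⊛ shift f) n + g (suc n) * f 0    ≈⟨ ⊛-last g f n ⟨
    (g ⊛ f) (suc n)                      ∎

  ⊛-distribʳ : ∀ h f g n → ((λ t → f t + g t) ⊛ h) n ≈ (f ⊛ h) n + (g ⊛ h) n
  ⊛-distribʳ h f g n = trans (Σ-cong n λ t → distribʳ _ _ _) (Σ-+ n _ _)

  ⊛-scale : ∀ x f g n → ((λ t → x * f t) ⊛ g) n ≈ x * (f ⊛ g) n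
  ⊛-scale x f g n = trans (Σ-cong n λ t → *-assoc _ _ _) (Σ-*ˡ n x _)

  -- Induction on the coefficient index, for all series at once: by `⊛-head`, a shifted product is f
  -- 0 times the shifted second factor plus the product with the first factor shifted.
  ⊛-assoc : ∀ f g h n → ((f ⊛ g) ⊛ h) n ≈ (f ⊛ (g ⊛ h)) n
  ⊛-assoc f g h zero = begin
    ((f ⊛ g) ⊛ h) 0      ≈⟨ ⊛-zero (f ⊛ g) h ⟩
    (f ⊛ g) 0 * h 0      ≈⟨ *-congʳ (⊛-zero f g) ⟩
    f 0 * g 0 * h 0      ≈⟨ *-assoc _ _ _ ⟩
    f 0 * (g 0 * h 0)    ≈⟨ *-congˡ (⊛-zero g h) ⟨
    f 0 * (g ⊛ h) 0      ≈⟨ ⊛-zero f (g ⊛ h) ⟨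
    (f ⊛ (g ⊛ h)) 0      ∎
  ⊛-assoc f g h (suc n) = begin
    ((f ⊛ g) ⊛ h) (suc n)
      ≈⟨ ⊛-head (f ⊛ g) h n ⟩
    (f ⊛ g) 0 * h (suc n) + (shift (f ⊛ g) ⊛ h) n
      ≈⟨ +-cong (trans (*-congʳ (⊛-zero f g)) (*-assoc _ _ _)) tail-step ⟩
    f 0 * (g 0 * h (suc n)) + (f 0 * (shift g ⊛ h) n + (shift f ⊛ (g ⊛ h)) n)
      ≈⟨ +-assoc _ _ _ ⟨
    f 0 * (g 0 * h (suc n)) + f 0 * (shift g ⊛ h) n + (shift f ⊛ (g ⊛ h)) n
      ≈⟨ +-congʳ (distribˡ (f 0) _ _) ⟨
    f 0 * (g 0 * h (suc n) + (shift g ⊛ h) n) + (shift f ⊛ (g ⊛ h)) n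
      ≈⟨ +-congʳ (*-congˡ (⊛-head g h n)) ⟨
    f 0 * (g ⊛ h) (suc n) + (shift f ⊛ (g ⊛ h)) n
      ≈⟨ ⊛-head f (g ⊛ h) n ⟨
    (f ⊛ (g ⊛ h)) (suc n)
      ∎
    where
    tail-step : (shift (f ⊛ g) ⊛ h) n ≈ f 0 * (shift g ⊛ h) n + (shift f ⊛ (g ⊛ h)) n
    tail-step = begin
      (shift (f ⊛ g) ⊛ h) n
        ≈⟨ Σ-cong n (λ t → *-congʳ (⊛-head f g t)) ⟩
      ((λ t → f 0 * g (suc t) + (shift f ⊛ g) t) ⊛ h) n
        ≈⟨ ⊛-distribʳ h _ _ n ⟩
      ((λ t → f 0 * g (suc t)) ⊛ h) n + ((shift f ⊛ g) ⊛ h) n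
        ≈⟨ +-cong (⊛-scale (f 0) (shift g) h n) (⊛-assoc (shift f) g h n) ⟩
      f 0 * (shift g ⊛ h) n + (shift f ⊛ (g ⊛ h)) n
        ∎

  ⊛-identityˡ : ∀ f n → (𝟙 ⊛ f) n ≈ f n
  ⊛-identityˡ f zero = trans (⊛-zero 𝟙 f) (trans (*-congʳ 𝟙-zero) (*-identityˡ _))
  ⊛-identityˡ f (suc n) = begin
    (𝟙 ⊛ f) (suc n)                      ≈⟨ ⊛-head 𝟙 f n ⟩
    𝟙 0 * f (suc n) + (shift 𝟙 ⊛ f) n    ≈⟨ +-cong (trans (*-congʳ 𝟙-zero) (*-identityˡ _))
                                              (Σ-0 n λ t _ → trans (*-congʳ (𝟙-suc t)) (zeroˡ _)) ⟩
    f (suc n) + 0#                       ≈⟨ +-identityʳ _ ⟩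
    f (suc n)                            ∎

  seriesRing : CommutativeRing 0ℓ 0ℓ
  seriesRing = record
    { Carrier = Series
    ; _≈_ = _≋_
    ; _+_ = λ f g n → f n + g n
    ; _*_ = _⊛_
    ; -_ = λ f n → - f n
    ; 0# = λ _ → 0#
    ; 1# = 𝟙
    ; isCommutativeRing = record
      { isRing = record
        { +-isAbelianGroup = record
          { isGroup = record
            { isMonoid = record
              { isSemigroup = record
                { isMagma = record
                  { isEquivalence = record
                    { refl = ptwise λ _ → refl
                    ; sym = λ p → ptwise λ n → sym (p .at n)
                    ; trans = λ p q → ptwise λ n → trans (p .at n) (q .at n)
                    }
                  ; ∙-cong = λ p q → ptwise λ n → +-cong (p .at n) (q .at n)
                  }
                ; assoc = λ f g h → ptwise λ n → +-assoc _ _ _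
                }
              ; identity = (λ f → ptwise λ n → +-identityˡ _) , (λ f → ptwise λ n → +-identityʳ _)
              }
            ; inverse = (λ f → ptwise λ n → -‿inverseˡ _) , (λ f → ptwise λ n → -‿inverseʳ _)
            ; ⁻¹-cong = λ p → ptwise λ n → -‿cong (p .at n)
            }
          ; comm = λ f g → ptwise λ n → +-comm _ _
          }
        ; *-cong = ⊛-cong
        ; *-assoc = λ f g h → ptwise (⊛-assoc f g h)
        ; *-identity = (λ f → ptwise (⊛-identityˡ f))
                     , (λ f → ptwise λ n → trans (⊛-comm f 𝟙 n) (⊛-identityˡ f n))
        ; distrib = (λ f g h → ptwise λ n → trans (⊛-comm f _ n)
                      (trans (⊛-distribʳ f g h n) (+-cong (⊛-comm g f n) (⊛-comm h f n))))
                  , (λ h f g → ptwise (⊛-distribʳ h f g))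
        }
      ; *-comm = λ f g → ptwise (⊛-comm f g)
      }
    }

-- Determinants

module Determinants (R : CommutativeRing 0ℓ 0ℓ) where

  open CommutativeRing R hiding (zero)
  open import Algebra.Properties.AbelianGroup +-abelianGroup using (⁻¹-∙-comm; ε⁻¹≈ε)
  open import Algebra.Properties.Ring (CommutativeRing.ring R) using (-‿distribʳ-*)
  open import Algebra.Solver.Ring.NaturalCoefficients.Default commutativeSemiring
  open import Relation.Binary.Reasoning.Setoid setoid

  -- The nesting f₀ - (f₁ - (f₂ - ...)) produces the signs of a cofactor expansion without powers of
  -- -1.
  altSum : ∀ k → (Fin k → Carrier) → Carrier
  altSum zero    f = 0#
  altSum (suc k) f = f zero - altSum k (λ i → f (suc i))

  altSum-cong : ∀ k {f g} → (∀ i → f i ≈ g i) → altSum k f ≈ altSum k g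
  altSum-cong zero    f≈g = refl
  altSum-cong (suc k) f≈g = +-cong (f≈g zero) (-‿cong (altSum-cong k λ i → f≈g (suc i)))

  altSum-0 : ∀ k {f} → (∀ i → f i ≈ 0#) → altSum k f ≈ 0#
  altSum-0 zero    f≈0 = refl
  altSum-0 (suc k) {f} f≈0 = begin
    f zero - altSum k (λ i → f (suc i))  ≈⟨ +-cong (f≈0 zero) (-‿cong (altSum-0 k λ i → f≈0 (suc i))) ⟩
    0# - 0#                              ≈⟨ -‿inverseʳ 0# ⟩
    0#                                   ∎

  altSum-linear : ∀ k x y f g →
    altSum k (λ i → x * f i + y * g i) ≈ x * altSum k f + y * altSum k g
  altSum-linear zero x y f g = sym (trans (+-cong (zeroʳ x) (zeroʳ y)) (+-identityˡ 0#))
  altSum-linear (suc k) x y f g = begin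
    (x * f₀ + y * g₀) - altSum k (λ i → x * f (suc i) + y * g (suc i))
      ≈⟨ +-congˡ (-‿cong (altSum-linear k x y _ _)) ⟩
    (x * f₀ + y * g₀) - (x * F + y * G)
      ≈⟨ +-congˡ (⁻¹-∙-comm _ _) ⟨
    (x * f₀ + y * g₀) + (- (x * F) + - (y * G))
      ≈⟨ +-congˡ (+-cong (-‿distribʳ-* x F) (-‿distribʳ-* y G)) ⟩
    (x * f₀ + y * g₀) + (x * - F + y * - G)
      ≈⟨ solve 6 (λ x y f g F G → (x :* f :+ y :* g) :+ (x :* F :+ y :* G)
                    := x :* (f :+ F) :+ y :* (g :+ G)) refl x y f₀ g₀ (- F) (- G) ⟩
    x * (f₀ - F) + y * (g₀ - G)
      ∎
    where
    f₀ = f zero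
    g₀ = g zero
    F = altSum k (λ i → f (suc i))
    G = altSum k (λ i → g (suc i))

  altSum-*ˡ : ∀ k x f → altSum k (λ i → x * f i) ≈ x * altSum k f
  altSum-*ˡ k x f = begin
    altSum k (λ i → x * f i)              ≈⟨ altSum-cong k (λ i → +0*0 (x * f i)) ⟨
    altSum k (λ i → x * f i + 0# * 0#)    ≈⟨ altSum-linear k x 0# f (λ _ → 0#) ⟩
    x * altSum k f + 0# * _               ≈⟨ trans (+-congˡ (zeroˡ _)) (+-identityʳ _) ⟩
    x * altSum k f                        ∎
    where
    +0*0 : ∀ y → y + 0# * 0# ≈ y
    +0*0 y = trans (+-congˡ (zeroˡ 0#)) (+-identityʳ y)

  altSum-sub : ∀ k f g → altSum k (λ i → f i - g i) ≈ altSum k f - altSum k g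
  altSum-sub zero f g = sym (-‿inverseʳ 0#)
  altSum-sub (suc k) f g = begin
    (f₀ - g₀) - altSum k (λ i → f (suc i) - g (suc i))
      ≈⟨ +-congˡ (-‿cong (altSum-sub k _ _)) ⟩
    (f₀ - g₀) - (F - G)
      ≈⟨ +-congˡ (⁻¹-∙-comm F (- G)) ⟨
    (f₀ - g₀) + (- F + - (- G))
      ≈⟨ solve 4 (λ f g F G → (f :+ g) :+ (F :+ G) := (f :+ F) :+ (g :+ G)) refl f₀ (- g₀) (- F) (- (- G)) ⟩
    (f₀ - F) + (- g₀ + - (- G))
      ≈⟨ +-congˡ (⁻¹-∙-comm g₀ (- G)) ⟩
    (f₀ - F) - (g₀ - G)
      ∎
    where
    f₀ = f zero
    g₀ = g zero
    F = altSum k (λ i → f (suc i))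
    G = altSum k (λ i → g (suc i))

  -- ψ j l belongs to the ordered pair of columns (j , punchIn j l); the
  -- hypothesis is symmetry in the two columns, which enter with opposite signs.
  altSum²-symmetric : ∀ n (ψ : Fin (suc n) → Fin n → Carrier) →
    (∀ j l → j Fin.≤ l → ψ (inject₁ j) l ≈ ψ (suc l) j) →
    altSum (suc n) (λ j → altSum n (ψ j)) ≈ 0#
  altSum²-symmetric zero ψ ψ-sym = -‿inverseʳ 0#
  altSum²-symmetric (suc n) ψ ψ-sym = begin
    A - altSum (suc n) (λ j → ψ (suc j) zero - altSum n (λ l → ψ (suc j) (suc l)))
      ≈⟨ +-congˡ (-‿cong (altSum-sub (suc n) (λ j → ψ (suc j) zero) (λ j → altSum n (λ l → ψ (suc j) (suc l))))) ⟩
    A - (B - C)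
      ≈⟨ +-congˡ (-‿cong (+-cong (sym A≈B) (-‿cong C≈0))) ⟩
    A - (A - 0#)
      ≈⟨ +-congˡ (-‿cong (trans (+-congˡ ε⁻¹≈ε) (+-identityʳ A))) ⟩
    A - A
      ≈⟨ -‿inverseʳ A ⟩
    0#
      ∎
    where
    A = altSum (suc n) (ψ zero)
    B = altSum (suc n) (λ j → ψ (suc j) zero)
    C = altSum (suc n) (λ j → altSum n (λ l → ψ (suc j) (suc l)))
    A≈B : A ≈ B
    A≈B = altSum-cong (suc n) λ l → ψ-sym zero l z≤n
    C≈0 : C ≈ 0#
    C≈0 = altSum²-symmetric n (λ j l → ψ (suc j) (suc l)) λ j l j≤l → ψ-sym (suc j) (suc l) (s≤s j≤l)

  Row : ℕ → Set
  Row m = Fin m → Carrier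

  minor : ∀ {k} → (Fin (suc k) → Row (suc k)) → Fin (suc k) → Fin k → Row k
  minor M j r c = M (suc r) (punchIn j c)

  det : ∀ k → (Fin k → Row k) → Carrier
  det zero    M = 1#
  det (suc k) M = altSum (suc k) λ j → M zero j * det k (minor M j)

  det-cong : ∀ k {M N} → (∀ i j → M i j ≈ N i j) → det k M ≈ det k N
  det-cong zero    M≈N = refl
  det-cong (suc k) M≈N = altSum-cong (suc k) λ j →
    *-cong (M≈N zero j) (det-cong k λ r c → M≈N (suc r) (punchIn j c))

  -- The three matrices are related entrywise instead of by a row update, so that the hypotheses
  -- restrict directly to the minors along the first row.
  det-linear : ∀ k (i : Fin k) {M A B} x y →
    (∀ r → r ≢ i → ∀ c → M r c ≈ A r c) →
    (∀ r → r ≢ i → ∀ c → M r c ≈ B r c) →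
    (∀ c → M i c ≈ x * A i c + y * B i c) →
    det k M ≈ x * det k A + y * det k B
  det-linear (suc k) zero {M} {A} {B} x y M≈A M≈B Mi = begin
    altSum (suc k) (λ j → M zero j * det k (minor M j))
      ≈⟨ altSum-cong (suc k) (λ j → begin
           M zero j * det k (minor M j)
             ≈⟨ *-congʳ (Mi j) ⟩
           (x * A zero j + y * B zero j) * det k (minor M j)
             ≈⟨ solve 5 (λ x y a b d → (x :* a :+ y :* b) :* d := x :* (a :* d) :+ y :* (b :* d))
                  refl x y (A zero j) (B zero j) (det k (minor M j)) ⟩
           x * (A zero j * det k (minor M j)) + y * (B zero j * det k (minor M j))
             ≈⟨ +-cong (*-congˡ (*-congˡ (det-cong k λ r c → M≈A (suc r) (λ ()) (punchIn j c))))
                       (*-congˡ (*-congˡ (det-cong k λ r c → M≈B (suc r) (λ ()) (punchIn j c)))) ⟩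
           x * (A zero j * det k (minor A j)) + y * (B zero j * det k (minor B j))
             ∎) ⟩
    altSum (suc k) (λ j → x * (A zero j * det k (minor A j)) + y * (B zero j * det k (minor B j)))
      ≈⟨ altSum-linear (suc k) x y (λ j → A zero j * det k (minor A j)) (λ j → B zero j * det k (minor B j)) ⟩
    x * det (suc k) A + y * det (suc k) B
      ∎
  det-linear (suc k) (suc i) {M} {A} {B} x y M≈A M≈B Mi = begin
    altSum (suc k) (λ j → M zero j * det k (minor M j))
      ≈⟨ altSum-cong (suc k) (λ j → begin
           M zero j * det k (minor M j)
             ≈⟨ *-congˡ (det-linear k i x y
                  (λ r r≢i c → M≈A (suc r) (λ { ≡.refl → r≢i ≡.refl }) (punchIn j c))
                  (λ r r≢i c → M≈B (suc r) (λ { ≡.refl → r≢i ≡.refl }) (punchIn j c))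
                  (λ c → Mi (punchIn j c))) ⟩
           M zero j * (x * det k (minor A j) + y * det k (minor B j))
             ≈⟨ solve 5 (λ x y m a b → m :* (x :* a :+ y :* b) := x :* (m :* a) :+ y :* (m :* b))
                  refl x y (M zero j) (det k (minor A j)) (det k (minor B j)) ⟩
           x * (M zero j * det k (minor A j)) + y * (M zero j * det k (minor B j))
             ≈⟨ +-cong (*-congˡ (*-congʳ (M≈A zero (λ ()) j))) (*-congˡ (*-congʳ (M≈B zero (λ ()) j))) ⟩
           x * (A zero j * det k (minor A j)) + y * (B zero j * det k (minor B j))
             ∎) ⟩
    altSum (suc k) (λ j → x * (A zero j * det k (minor A j)) + y * (B zero j * det k (minor B j)))
      ≈⟨ altSum-linear (suc k) x y (λ j → A zero j * det k (minor A j)) (λ j → B zero j * det k (minor B j)) ⟩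
    x * det (suc k) A + y * det (suc k) B
      ∎

  -- If columns j and l + 1 with j ≤ l are deleted in succession, the second one is addressed as l
  -- or as j, depending on which goes first. This lemma and the next two reconcile the two orders.
  punchIn-inject₁ : ∀ {n} (j l : Fin n) → j Fin.≤ l → punchIn (inject₁ j) l ≡ suc l
  punchIn-inject₁ zero    l       _         = ≡.refl
  punchIn-inject₁ (suc j) (suc l) (s≤s j≤l) = ≡.cong suc (punchIn-inject₁ j l j≤l)

  punchIn-suc : ∀ {n} (j l : Fin n) → j Fin.≤ l → punchIn (suc l) j ≡ inject₁ j
  punchIn-suc zero    l       _         = ≡.refl
  punchIn-suc (suc j) (suc l) (s≤s j≤l) = ≡.cong suc (punchIn-suc j l j≤l)

  punchIn-punchIn : ∀ {n} (j l : Fin (suc n)) c → j Fin.≤ l →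
    punchIn (inject₁ j) (punchIn l c) ≡ punchIn (suc l) (punchIn j c)
  punchIn-punchIn zero    l       c       _         = ≡.refl
  punchIn-punchIn (suc j) (suc l) zero    (s≤s j≤l) = ≡.refl
  punchIn-punchIn (suc j) (suc l) (suc c) (s≤s j≤l) = ≡.cong suc (punchIn-punchIn j l c j≤l)

  -- Expansion along the first row strips the rows above the pair. Once the pair is on top,
  -- expanding along both of its rows gives a double alternating sum whose terms are symmetric in
  -- the two chosen columns, and `altSum²-symmetric` cancels it.
  det-adjacent-equal : ∀ k (i j : Fin k) → toℕ j ≡ suc (toℕ i) → ∀ {M} →
    (∀ c → M i c ≈ M j c) → det k M ≈ 0#
  det-adjacent-equal (suc (suc k)) zero (suc zero) _ {M} M₀≈M₁ = begin
    altSum (suc (suc k)) (λ j → a j * altSum (suc k) (λ l → b (punchIn j l) * D j l))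
      ≈⟨ altSum-cong (suc (suc k)) (λ j → altSum-*ˡ (suc k) (a j) (λ l → b (punchIn j l) * D j l)) ⟨
    altSum (suc (suc k)) (λ j → altSum (suc k) (ψ j))
      ≈⟨ altSum²-symmetric (suc k) ψ ψ-sym ⟩
    0#
      ∎
    where
    a b : Row (suc (suc k))
    a = M zero
    b = M (suc zero)
    D : Fin (suc (suc k)) → Fin (suc k) → Carrier
    D j l = det k λ r c → M (suc (suc r)) (punchIn j (punchIn l c))
    ψ : Fin (suc (suc k)) → Fin (suc k) → Carrier
    ψ j l = a j * (b (punchIn j l) * D j l)
    ψ-sym : ∀ j l → j Fin.≤ l → ψ (inject₁ j) l ≈ ψ (suc l) j
    ψ-sym j l j≤l = begin
      a (inject₁ j) * (b (punchIn (inject₁ j) l) * D (inject₁ j) l)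
        ≈⟨ *-cong (M₀≈M₁ _) (*-cong
             (trans (reflexive (≡.cong b (punchIn-inject₁ j l j≤l))) (sym (M₀≈M₁ _)))
             (det-cong k λ r c → reflexive (≡.cong (M (suc (suc r))) (punchIn-punchIn j l c j≤l)))) ⟩
      b (inject₁ j) * (a (suc l) * D (suc l) j)
        ≈⟨ solve 3 (λ x y d → x :* (y :* d) := y :* (x :* d)) refl _ _ _ ⟩
      a (suc l) * (b (inject₁ j) * D (suc l) j)
        ≈⟨ *-congˡ (*-congʳ (reflexive (≡.cong b (≡.sym (punchIn-suc j l j≤l))))) ⟩
      a (suc l) * (b (punchIn (suc l) j) * D (suc l) j)
        ∎
  det-adjacent-equal (suc k) (suc i) (suc j) j≡1+i {M} Mi≈Mj = altSum-0 (suc k) λ l →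
    trans (*-congˡ {M zero l} (det-adjacent-equal k i j (ℕₚ.suc-injective j≡1+i) λ c → Mi≈Mj (punchIn l c)))
          (zeroʳ _)

  -- A minor that deletes another column keeps the zeros as its own first column, so the induction
  -- hypothesis gives it a factor 0.
  det-first-column : ∀ k {M : Fin (suc k) → Row (suc k)} → (∀ i → M (suc i) zero ≈ 0#) →
    det (suc k) M ≈ M zero zero * det k (λ r c → M (suc r) (suc c))
  det-first-column zero M≈0 = trans (+-congˡ ε⁻¹≈ε) (+-identityʳ _)
  det-first-column (suc k) {M} M≈0 = begin
    M zero zero * D - altSum (suc k) (λ j → M zero (suc j) * det (suc k) (minor M (suc j)))
      ≈⟨ +-congˡ (-‿cong (altSum-0 (suc k) λ j → begin
           M zero (suc j) * det (suc k) (minor M (suc j))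
             ≈⟨ *-congˡ (det-first-column k {minor M (suc j)} λ i → M≈0 (suc i)) ⟩
           M zero (suc j) * (M (suc zero) zero * _)
             ≈⟨ *-congˡ (trans (*-congʳ (M≈0 zero)) (zeroˡ _)) ⟩
           M zero (suc j) * 0#
             ≈⟨ zeroʳ _ ⟩
           0#
             ∎)) ⟩
    M zero zero * D - 0#
      ≈⟨ trans (+-congˡ ε⁻¹≈ε) (+-identityʳ _) ⟩
    M zero zero * D
      ∎
    where D = det (suc k) λ r c → M (suc r) (suc c)

-- Total positivity of Hankel matrices

-- In a weakly increasing sequence a repetition already occurs between neighbours, the form that
-- `det-adjacent-equal` accepts.
increasing-or-repeats : ∀ k (d : Fin k → ℕ) → (∀ i j → i Fin.< j → d i ℕ.≤ d j) →
  StrictlyIncreasing d ⊎ ∃₂ λ i j → toℕ j ≡ suc (toℕ i) × d i ≡ d j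
increasing-or-repeats zero d d-mono = inj₁ λ ()
increasing-or-repeats (suc zero) d d-mono = inj₁ λ { zero zero () }
increasing-or-repeats (suc (suc k)) d d-mono
  with d zero ℕ.≟ d (suc zero)
     | increasing-or-repeats (suc k) (λ i → d (suc i)) (λ i j i<j → d-mono (suc i) (suc j) (s≤s i<j))
... | yes d₀≡d₁ | _ = inj₂ (zero , suc zero , ≡.refl , d₀≡d₁)
... | no _ | inj₂ (i , j , j≡1+i , dᵢ≡dⱼ) = inj₂ (suc i , suc j , ≡.cong suc j≡1+i , dᵢ≡dⱼ)
... | no d₀≢d₁ | inj₁ d-inc = inj₁ inc
  where
  d₀<d₁ : d zero ℕ.< d (suc zero)
  d₀<d₁ = ℕₚ.≤∧≢⇒< (d-mono zero (suc zero) (s≤s z≤n)) d₀≢d₁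
  inc : StrictlyIncreasing d
  inc zero (suc zero)    _ = d₀<d₁
  inc zero (suc (suc j)) _ = ℕₚ.<-trans d₀<d₁ (d-inc zero (suc j) (s≤s z≤n))
  inc (suc i) (suc j) (s≤s i<j) = d-inc i j i<j

-- An abstract cone closed under sums and products keeps finite supports and coefficient signs out
-- of the determinant arguments.
record Positivity (R : CommutativeRing 0ℓ 0ℓ) : Set₁ where
  open CommutativeRing R
  field
    Pos : Carrier → Set
    Pos-resp : ∀ {x y} → x ≈ y → Pos x → Pos y
    Pos-0 : Pos 0#
    Pos-1 : Pos 1#
    Pos-+ : ∀ {x y} → Pos x → Pos y → Pos (x + y)
    Pos-* : ∀ {x y} → Pos x → Pos y → Pos (x * y)

module TotalPositivity (R : CommutativeRing 0ℓ 0ℓ) (𝒫 : Positivity R) where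

  open CommutativeRing R hiding (zero)
  open Positivity 𝒫
  open Determinants R
  open import Relation.Binary.Reasoning.Setoid setoid

  -- The number `k` of rows and their length `m` are independent, because fixing the first row of a
  -- determinant leaves a form in fewer rows of the same length.
  record Multilinear {k m} (F : (Fin k → Row m) → Carrier) : Set where
    field
      F-cong : ∀ {M N} → (∀ i j → M i j ≈ N i j) → F M ≈ F N
      F-linear : ∀ i {M A B} x y →
        (∀ r → r ≢ i → ∀ c → M r c ≈ A r c) →
        (∀ r → r ≢ i → ∀ c → M r c ≈ B r c) →
        (∀ c → M i c ≈ x * A i c + y * B i c) →
        F M ≈ x * F A + y * F B

  det-multilinear : ∀ k → Multilinear (det k)
  det-multilinear k = record { F-cong = det-cong k ; F-linear = det-linear k }

  Multilinear-∷ : ∀ {k m} {F : (Fin (suc k) → Row m) → Carrier} → Multilinear F →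
    ∀ v → Multilinear (λ M → F (v ∷ M))
  Multilinear-∷ F-mul v = record
    { F-cong = λ M≈N → F-cong λ { zero j → refl ; (suc i) j → M≈N i j }
    ; F-linear = λ i x y M≈A M≈B Mi → F-linear (suc i) x y
        (λ { zero _ c → refl ; (suc r) r≢i c → M≈A r (λ r≡i → r≢i (≡.cong suc r≡i)) c })
        (λ { zero _ c → refl ; (suc r) r≢i c → M≈B r (λ r≡i → r≢i (≡.cong suc r≡i)) c })
        Mi
    }
    where open Multilinear F-mul

  -- Splitting the first row gives two forms with that row fixed. After all rows are split, the
  -- value is a sum over the choices `d` of p or q in each row, weighted by products of the `x i`
  -- and `y i`.
  multilinear-expand : ∀ {k m} {F : (Fin k → Row m) → Carrier} → Multilinear F →
    (N : ℕ → Row m) (p q : Fin k → ℕ) (x y : Fin k → Carrier) →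
    (∀ i → Pos (x i)) → (∀ i → Pos (y i)) →
    (∀ (d : Fin k → ℕ) → (∀ i → d i ≡ p i ⊎ d i ≡ q i) → Pos (F (λ i → N (d i)))) →
    Pos (F (λ i c → x i * N (p i) c + y i * N (q i) c))
  multilinear-expand {zero} F-mul N p q x y x≥0 y≥0 F≥0 =
    Pos-resp (F-cong λ ()) (F≥0 p λ ())
    where open Multilinear F-mul
  multilinear-expand {suc k} {m} {F} F-mul N p q x y x≥0 y≥0 F≥0 =
    Pos-resp
      (sym (F-linear zero (x zero) (y zero)
        (λ { zero 0≢0 → ⊥-elim (0≢0 ≡.refl) ; (suc r) _ c → refl })
        (λ { zero 0≢0 → ⊥-elim (0≢0 ≡.refl) ; (suc r) _ c → refl })
        (λ c → refl)))
      (Pos-+ (Pos-* (x≥0 zero) (fixFirst (p zero) (inj₁ ≡.refl)))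
             (Pos-* (y≥0 zero) (fixFirst (q zero) (inj₂ ≡.refl))))
    where
    open Multilinear F-mul
    fixFirst : ∀ n → n ≡ p zero ⊎ n ≡ q zero →
      Pos (F (N n ∷ λ i c → x (suc i) * N (p (suc i)) c + y (suc i) * N (q (suc i)) c))
    fixFirst n n≡ = multilinear-expand (Multilinear-∷ F-mul (N n)) N
      (λ i → p (suc i)) (λ i → q (suc i)) (λ i → x (suc i)) (λ i → y (suc i))
      (λ i → x≥0 (suc i)) (λ i → y≥0 (suc i))
      λ d d≡ → Pos-resp (F-cong λ { zero c → refl ; (suc i) c → refl })
        (F≥0 (n ∷ d) λ { zero → n≡ ; (suc i) → d≡ i })

  -- Only minors using all `k` columns occur: row operations act on every column alike, so a
  -- selection of columns can be made beforehand and stay fixed.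
  record PosMinors {k} (N : ℕ → Row k) : Set where
    constructor posMinors
    field minor≥0 : ∀ r → StrictlyIncreasing r → Pos (det k (λ i → N (r i)))
  open PosMinors

  PosMinors-resp : ∀ {k} {N N′ : ℕ → Row k} → (∀ i c → N i c ≈ N′ i c) →
    PosMinors N → PosMinors N′
  PosMinors-resp {k} N≈N′ N≥0 .minor≥0 r r-inc =
    Pos-resp (det-cong k λ i c → N≈N′ (r i) c) (N≥0 .minor≥0 r r-inc)

  -- Expanding by multilinearity, a minor of N′ becomes a positive combination
  -- of determinants with weakly increasing row indices d; these are minors of
  -- N, or vanish because two adjacent rows coincide.
  PosMinors-combine : ∀ {k} {N N′ : ℕ → Row k} (p q : ℕ → ℕ) (x y : ℕ → Carrier) →
    (∀ i → p i ℕ.≤ q i) → (∀ i → q i ℕ.≤ p (suc i)) →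
    (∀ i → Pos (x i)) → (∀ i → Pos (y i)) →
    (∀ i c → x i * N (p i) c + y i * N (q i) c ≈ N′ i c) →
    PosMinors N → PosMinors N′
  PosMinors-combine {k} {N} {N′} p q x y p≤q q≤p x≥0 y≥0 N′≈ N≥0 =
    PosMinors-resp N′≈ (posMinors λ r r-inc →
      multilinear-expand (det-multilinear k) N (λ i → p (r i)) (λ i → q (r i))
        (λ i → x (r i)) (λ i → y (r i)) (λ i → x≥0 (r i)) (λ i → y≥0 (r i))
        (resolved r r-inc))
    where
    q≤p-< : ∀ a {b} → a ℕ.< b → q a ℕ.≤ p b
    q≤p-< a {suc b} (s≤s a≤b) with ℕₚ.m≤n⇒m<n∨m≡n a≤b
    ... | inj₂ ≡.refl = q≤p a
    ... | inj₁ a<b = ℕₚ.≤-trans (q≤p-< a a<b) (ℕₚ.≤-trans (p≤q b) (q≤p b))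

    resolved : ∀ r → StrictlyIncreasing r → ∀ d → (∀ i → d i ≡ p (r i) ⊎ d i ≡ q (r i)) →
      Pos (det k (λ i → N (d i)))
    resolved r r-inc d d≡ with increasing-or-repeats k d d-mono
      where
      d≤q : ∀ i → d i ℕ.≤ q (r i)
      d≤q i with d≡ i
      ... | inj₁ eq = ℕₚ.≤-trans (ℕₚ.≤-reflexive eq) (p≤q (r i))
      ... | inj₂ eq = ℕₚ.≤-reflexive eq
      p≤d : ∀ i → p (r i) ℕ.≤ d i
      p≤d i with d≡ i
      ... | inj₁ eq = ℕₚ.≤-reflexive (≡.sym eq)
      ... | inj₂ eq = ℕₚ.≤-trans (p≤q (r i)) (ℕₚ.≤-reflexive (≡.sym eq))
      d-mono : ∀ i j → i Fin.< j → d i ℕ.≤ d j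
      d-mono i j i<j = ℕₚ.≤-trans (d≤q i) (ℕₚ.≤-trans (q≤p-< (r i) (r-inc i j i<j)) (p≤d j))
    ... | inj₁ d-inc = N≥0 .minor≥0 d d-inc
    ... | inj₂ (i , j , j≡1+i , dᵢ≡dⱼ) = Pos-resp
      (sym (det-adjacent-equal k i j j≡1+i λ c → reflexive (≡.cong (λ n → N n c) dᵢ≡dⱼ))) Pos-0

-- The tableau of weighted path sums and its Hankel matrix

module StieltjesTableau (R : CommutativeRing 0ℓ 0ℓ) (e o : ℕ → CommutativeRing.Carrier R) where

  open CommutativeRing R hiding (zero)

  -- With α₀, α₁, α₂, … = e 0, o 0, e 1, …, the entries L n k and L′ n k are the
  -- weighted sums over partial Dyck paths ending after 2n steps at height 2k,
  -- resp. after 2n+1 steps at height 2k+1.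
  mutual
    L : ℕ → ℕ → Carrier
    L zero    zero    = 1#
    L zero    (suc k) = 0#
    L (suc n) zero    = e 0 * L′ n 0
    L (suc n) (suc k) = L′ n k + e (suc k) * L′ n (suc k)

    L′ : ℕ → ℕ → Carrier
    L′ n k = L n k + o k * L n (suc k)

  L-upper : ∀ n k → n ℕ.< k → L n k ≈ 0#
  L-upper zero (suc k) _ = refl
  L-upper (suc n) (suc k) (s≤s n<k) = begin
    L n k + o k * L n (suc k) + e (suc k) * (L n (suc k) + o (suc k) * L n (suc (suc k)))
      ≈⟨ +-cong (+-cong (L-upper n k n<k) (*-congˡ (L-upper n (suc k) (ℕₚ.m≤n⇒m≤1+n n<k))))
           (*-congˡ (+-cong (L-upper n (suc k) (ℕₚ.m≤n⇒m≤1+n n<k))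
             (*-congˡ (L-upper n (suc (suc k)) (ℕₚ.m≤n⇒m≤1+n (ℕₚ.m≤n⇒m≤1+n n<k)))))) ⟩
    0# + o k * 0# + e (suc k) * (0# + o (suc k) * 0#)
      ≈⟨ solve 3 (λ x y z → con 0 :+ x :* con 0 :+ y :* (con 0 :+ z :* con 0) := con 0) refl _ _ _ ⟩
    0#
      ∎
    where
    open import Algebra.Solver.Ring.NaturalCoefficients.Default commutativeSemiring
    open import Relation.Binary.Reasoning.Setoid setoid

  module HankelMinors (𝒫 : Positivity R)
      (e≥0 : ∀ k → Positivity.Pos 𝒫 (e k)) (o≥0 : ∀ k → Positivity.Pos 𝒫 (o k)) where

    open Positivity 𝒫
    open TotalPositivity R 𝒫
    open PosMinors
    open Determinants R
    open import Relation.Binary.Reasoning.Setoid setoid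

    -- Coefficient of row k - 1 in a combination for row k. It vanishes at k = 0, where `pred 0`
    -- would otherwise count row 0 twice.
    lowerWeight : ℕ → Carrier
    lowerWeight zero    = 0#
    lowerWeight (suc _) = 1#

    lowerWeight≥0 : ∀ k → Pos (lowerWeight k)
    lowerWeight≥0 zero    = Pos-0
    lowerWeight≥0 (suc _) = Pos-1

    -- Rows are heights and columns are times, so one time step is a row operation. If all times are
    -- positive, two bidiagonal operations move every time back by one. If the first time is 0, its
    -- column is (1, 0, 0, ...) and is split off. The pair (n, m) decreases lexicographically.
    L-minors-< : ∀ n m (c : Fin m → ℕ) → StrictlyIncreasing c → (∀ j → c j ℕ.< n) →
      PosMinors (λ k j → L (c j) k)
    L-minors-< n zero c c-inc c<n = posMinors λ _ _ → Pos-1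
    L-minors-< zero (suc m) c c-inc c<n with c<n zero
    ... | ()
    L-minors-< (suc n) (suc m) c c-inc c<n with c zero ℕ.≟ 0
    ... | no c₀≢0 = PosMinors-combine pred (λ k → k) lowerWeight e
        (λ k → ℕₚ.pred[n]≤n) (λ k → ℕₚ.≤-refl) lowerWeight≥0 e≥0 L-step
        (PosMinors-combine (λ k → k) suc (λ _ → 1#) o
          (λ k → ℕₚ.n≤1+n k) (λ k → ℕₚ.≤-refl) (λ _ → Pos-1) o≥0
          (λ k j → +-congʳ (*-identityˡ _))
          (L-minors-< n (suc m) (λ j → pred (c j)) pred-inc pred<n))
      where
      c≡suc : ∀ j → c j ≡ suc (pred (c j))
      c≡suc zero = ≡.sym (ℕₚ.suc-pred (c zero) {{ℕ.≢-nonZero c₀≢0}})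
      c≡suc (suc j) with c (suc j) | c-inc zero (suc j) (s≤s z≤n)
      ... | suc _ | _ = ≡.refl
      pred-inc : StrictlyIncreasing (λ j → pred (c j))
      pred-inc i j i<j = ℕₚ.≤-pred (≡.subst₂ ℕ._<_ (c≡suc i) (c≡suc j) (c-inc i j i<j))
      pred<n : ∀ j → pred (c j) ℕ.< n
      pred<n j = ℕₚ.≤-pred (≡.subst (ℕ._< suc n) (c≡suc j) (c<n j))
      L-step : ∀ k j → lowerWeight k * L′ (pred (c j)) (pred k) + e k * L′ (pred (c j)) k ≈ L (c j) k
      L-step zero j rewrite c≡suc j = trans (+-congʳ (zeroˡ _)) (+-identityˡ _)
      L-step (suc k) j rewrite c≡suc j = +-congʳ (*-identityˡ _)
    ... | yes c₀≡0 = first-column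
      where
      later-rows : ∀ k → 1 ℕ.≤ k → L (c zero) k ≈ 0#
      later-rows (suc k) _ rewrite c₀≡0 = refl
      first-column : PosMinors (λ k j → L (c j) k)
      first-column .minor≥0 r r-inc = Pos-resp
        (sym (det-first-column m {λ i j → L (c j) (r i)} λ i → later-rows (r (suc i)) (ℕₚ.≤-trans (s≤s z≤n) (r-inc zero (suc i) (s≤s z≤n)))))
        (Pos-* (corner (r zero))
          (L-minors-< (suc n) m (λ j → c (suc j)) (λ i j i<j → c-inc (suc i) (suc j) (s≤s i<j))
            (λ j → c<n (suc j)) .minor≥0 (λ i → r (suc i)) (λ i j i<j → r-inc (suc i) (suc j) (s≤s i<j))))
        where
        corner : ∀ k → Pos (L (c zero) k)
        corner k rewrite c₀≡0 with k
        ... | zero = Pos-1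
        ... | suc _ = Pos-0

    -- Hankel rows i < t on top of the rows L (j + t) (i − t); a step t → t + 1
    -- turns the tableau rows into one more Hankel row, through half.
    stage half : ℕ → ℕ → ℕ → Carrier
    stage zero    k       j = L j k
    stage (suc t) zero    j = L j 0
    stage (suc t) (suc k) j = stage t k (suc j)
    half zero    zero    j = L j 0
    half zero    (suc k) j = L′ j k
    half (suc t) zero    j = L j 0
    half (suc t) (suc k) j = half t k (suc j)

    -- Coefficients of the old rows k - 1 and k in the new row k. They form the identity on the
    -- Hankel rows already present and one bidiagonal factor of the tableau step below them;
    -- likewise for `stage-lower` and `stage-diagonal`.
    half-lower half-diagonal : ℕ → ℕ → Carrier
    half-lower zero    k       = lowerWeight k
    half-lower (suc t) zero    = 0#
    half-lower (suc t) (suc k) = half-lower t k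
    half-diagonal zero    zero    = 1#
    half-diagonal zero    (suc k) = o k
    half-diagonal (suc t) zero    = 1#
    half-diagonal (suc t) (suc k) = half-diagonal t k

    stage-lower stage-diagonal : ℕ → ℕ → Carrier
    stage-lower zero    zero    = 0#
    stage-lower zero    (suc k) = lowerWeight k
    stage-lower (suc t) zero    = 0#
    stage-lower (suc t) (suc k) = stage-lower t k
    stage-diagonal zero    zero    = 1#
    stage-diagonal zero    (suc k) = e k
    stage-diagonal (suc t) zero    = 1#
    stage-diagonal (suc t) (suc k) = stage-diagonal t k

    half-lower≥0 : ∀ t k → Pos (half-lower t k)
    half-lower≥0 zero    k       = lowerWeight≥0 k
    half-lower≥0 (suc t) zero    = Pos-0
    half-lower≥0 (suc t) (suc k) = half-lower≥0 t k

    half-diagonal≥0 : ∀ t k → Pos (half-diagonal t k)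
    half-diagonal≥0 zero    zero    = Pos-1
    half-diagonal≥0 zero    (suc k) = o≥0 k
    half-diagonal≥0 (suc t) zero    = Pos-1
    half-diagonal≥0 (suc t) (suc k) = half-diagonal≥0 t k

    stage-lower≥0 : ∀ t k → Pos (stage-lower t k)
    stage-lower≥0 zero    zero    = Pos-0
    stage-lower≥0 zero    (suc k) = lowerWeight≥0 k
    stage-lower≥0 (suc t) zero    = Pos-0
    stage-lower≥0 (suc t) (suc k) = stage-lower≥0 t k

    stage-diagonal≥0 : ∀ t k → Pos (stage-diagonal t k)
    stage-diagonal≥0 zero    zero    = Pos-1
    stage-diagonal≥0 zero    (suc k) = e≥0 k
    stage-diagonal≥0 (suc t) zero    = Pos-1
    stage-diagonal≥0 (suc t) (suc k) = stage-diagonal≥0 t k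

    half-lower-0 : ∀ t → half-lower t 0 ≈ 0#
    half-lower-0 zero    = refl
    half-lower-0 (suc t) = refl

    stage-lower-0 : ∀ t → stage-lower t 0 ≈ 0#
    stage-lower-0 zero    = refl
    stage-lower-0 (suc t) = refl

    0*x+1*y : ∀ x y → 0# * x + 1# * y ≈ y
    0*x+1*y x y = trans (+-cong (zeroˡ x) (*-identityˡ y)) (+-identityˡ y)

    -- Needed at k = 1: removing one Hankel row sends k to 0, where `pred` no longer names the same
    -- row, but the coefficient in front is zero.
    0*-irrelevant : ∀ {z} → z ≈ 0# → ∀ x y → z * x ≈ z * y
    0*-irrelevant z≈0 x y = trans (trans (*-congʳ z≈0) (zeroˡ x)) (sym (trans (*-congʳ z≈0) (zeroˡ y)))

    half-combine : ∀ t k j →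
      half-lower t k * stage t (pred k) j + half-diagonal t k * stage t k j ≈ half t k j
    half-combine zero    zero          j = 0*x+1*y _ _
    half-combine zero    (suc k)       j = +-congʳ (*-identityˡ _)
    half-combine (suc t) zero          j = 0*x+1*y _ _
    half-combine (suc t) (suc zero)    j =
      trans (+-congʳ (0*-irrelevant (half-lower-0 t) _ _)) (half-combine t zero (suc j))
    half-combine (suc t) (suc (suc k)) j = half-combine t (suc k) (suc j)

    stage-combine : ∀ t k j →
      stage-lower t k * half t (pred k) j + stage-diagonal t k * half t k j ≈ stage (suc t) k j
    stage-combine zero    zero          j = 0*x+1*y _ _
    stage-combine zero    (suc zero)    j = trans (+-congʳ (zeroˡ _)) (+-identityˡ _)
    stage-combine zero    (suc (suc k)) j = +-congʳ (*-identityˡ _)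
    stage-combine (suc t) zero          j = 0*x+1*y _ _
    stage-combine (suc t) (suc zero)    j =
      trans (+-congʳ (0*-irrelevant (stage-lower-0 t) _ _)) (stage-combine t zero (suc j))
    stage-combine (suc t) (suc (suc k)) j = stage-combine t (suc k) (suc j)

    bounded : ∀ {k} (r : Fin k → ℕ) → ∃ λ t → ∀ i → r i ℕ.< t
    bounded {zero} r = 0 , λ ()
    bounded {suc k} r with bounded (λ i → r (suc i))
    ... | t , r<t = suc (r zero) ℕ.⊔ t ,
      λ { zero → ℕₚ.m≤m⊔n (suc (r zero)) t ; (suc i) → ℕₚ.≤-trans (r<t i) (ℕₚ.m≤n⊔m (suc (r zero)) t) }

    stage-minors : ∀ t {m} (c : Fin m → ℕ) → StrictlyIncreasing c → PosMinors (λ k j → stage t k (c j))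
    stage-minors zero c c-inc =
      L-minors-< (proj₁ (bounded c)) _ c c-inc (proj₂ (bounded c))
    stage-minors (suc t) c c-inc =
      PosMinors-combine pred (λ k → k) (stage-lower t) (stage-diagonal t)
        (λ k → ℕₚ.pred[n]≤n) (λ k → ℕₚ.≤-refl) (stage-lower≥0 t) (stage-diagonal≥0 t)
        (λ k j → stage-combine t k (c j))
        (PosMinors-combine pred (λ k → k) (half-lower t) (half-diagonal t)
          (λ k → ℕₚ.pred[n]≤n) (λ k → ℕₚ.≤-refl) (half-lower≥0 t) (half-diagonal≥0 t)
          (λ k j → half-combine t k (c j))
          (stage-minors t c c-inc))

    stage-Hankel : ∀ t i j → i ℕ.< t → stage t i j ≡ L (i ℕ.+ j) 0
    stage-Hankel (suc t) zero    j _         = ≡.refl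
    stage-Hankel (suc t) (suc i) j (s≤s i<t) =
      ≡.trans (stage-Hankel t i (suc j) i<t) (≡.cong (λ n → L n 0) (ℕₚ.+-suc i j))

    -- With `t` beyond all selected rows, the minor of `stage t` sees Hankel rows only.
    Hankel-minors : ∀ k (r c : Fin k → ℕ) → StrictlyIncreasing r → StrictlyIncreasing c →
      Pos (det k (λ i j → L (r i ℕ.+ c j) 0))
    Hankel-minors k r c r-inc c-inc with bounded r
    ... | t , r<t = Pos-resp (det-cong k λ i j → reflexive (stage-Hankel t (r i) (c j) (r<t i)))
      (stage-minors t c c-inc .minor≥0 r r-inc)

-- Log-convexity from Hankel minors

-- The condensation identities rest on cancellation, so their normal forms need integer
-- coefficients.
ℤ-scalars : CommutativeRing 0ℓ 0ℓ → Set
ℤ-scalars R = CommutativeRing.rawRing ℤₚ.+-*-commutativeRing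
  -Raw-AlmostCommutative⟶ fromCommutativeRing R

-- Cofactor expansion of a (k+1) × (k+1) determinant without the constants 0
-- and 1, so that it applies verbatim to the expressions of the ring solver.
module Laplace {A : Set} (_*_ _-_ : A → A → A) where

  altSum⁺ : ∀ k → (Fin (suc k) → A) → A
  altSum⁺ zero    f = f zero
  altSum⁺ (suc k) f = f zero - altSum⁺ k (λ i → f (suc i))

  det⁺ : ∀ k → (Fin (suc k) → Fin (suc k) → A) → A
  det⁺ zero    M = M zero zero
  det⁺ (suc k) M = altSum⁺ (suc k) λ j → M zero j * det⁺ k (λ r c → M (suc r) (punchIn j c))

  Hankel⁺ : ∀ k → (ℕ → A) → A
  Hankel⁺ k s = det⁺ k λ i j → s (toℕ i ℕ.+ toℕ j)

  𝓛 : (ℕ → A) → (ℕ → A)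
  𝓛 s i = (s i * s (suc (suc i))) - (s (suc i) * s (suc i))

module LogConvexity (R : CommutativeRing 0ℓ 0ℓ) (𝒫 : Positivity R) (ι : ℤ-scalars R) where

  open CommutativeRing R hiding (zero)
  open Positivity 𝒫
  open Determinants R
  open _-Raw-AlmostCommutative⟶_ ι using (⟦_⟧)
  open import Relation.Binary.Reasoning.Setoid setoid

  ι-≟ : ∀ m n → Maybe (⟦ m ⟧ ≈ ⟦ n ⟧)
  ι-≟ m n = map (λ { ≡.refl → refl }) (dec⇒weaklyDec ℤ._≟_ m n)

  open Algebra.Solver.Ring (CommutativeRing.rawRing ℤₚ.+-*-commutativeRing) (fromCommutativeRing R) ι ι-≟
    using (solve; _:=_; _:+_; _:*_; _:-_)

  open Laplace _*_ _-_
  module Syntax {n} = Laplace (_:*_ {n}) _:-_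
  open import Algebra.Properties.AbelianGroup +-abelianGroup using (ε⁻¹≈ε)

  altSum⁺-correct : ∀ k f → altSum (suc k) f ≈ altSum⁺ k f
  altSum⁺-correct zero    f = trans (+-congˡ ε⁻¹≈ε) (+-identityʳ _)
  altSum⁺-correct (suc k) f = +-congˡ (-‿cong (altSum⁺-correct k λ i → f (suc i)))

  det⁺-correct : ∀ k M → det (suc k) M ≈ det⁺ k M
  det⁺-correct zero    M = trans (altSum⁺-correct 0 λ _ → M zero zero * 1#) (*-identityʳ _)
  det⁺-correct (suc k) M = trans
    (altSum-cong (suc (suc k)) λ j → *-congˡ {M zero j} (det⁺-correct k (minor M j)))
    (altSum⁺-correct (suc k) λ j → M zero j * det⁺ k (minor M j))

  -- Turns finitely many solver variables into a sequence, so that `Syntax.Hankel⁺` and `Syntax.𝓛`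
  -- reduce to polynomial expressions in them; later entries are padding.
  tuple : ∀ {A : Set} (a b c d e f g : A) → ℕ → A
  tuple a b c d e f g 0 = a
  tuple a b c d e f g 1 = b
  tuple a b c d e f g 2 = c
  tuple a b c d e f g 3 = d
  tuple a b c d e f g 4 = e
  tuple a b c d e f g 5 = f
  tuple a b c d e f g _ = g

  -- The corner 2 × 2 minors of a 3 × 3 Hankel matrix are 𝓛 s 0, 𝓛 s 2 and twice 𝓛 s 1; the central
  -- entry is s 2.
  dodgson₃ : ∀ s → 𝓛 (𝓛 s) 0 ≈ s 2 * Hankel⁺ 2 s
  dodgson₃ s = solve 5 (λ a b c d e → let t = tuple a b c d e e e in
    Syntax.𝓛 (Syntax.𝓛 t) 0 := c :* Syntax.Hankel⁺ 2 t) refl (s 0) (s 1) (s 2) (s 3) (s 4)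

  -- The same condensation one order higher: the corners are contiguous 3 × 3 Hankel minors, and the
  -- central 2 × 2 minor is 𝓛 s 2.
  dodgson₄ : ∀ s → 𝓛 (λ i → Hankel⁺ 2 (λ j → s (i ℕ.+ j))) 0 ≈ Hankel⁺ 3 s * 𝓛 s 2
  dodgson₄ s = solve 7 (λ a b c d e f g → let t = tuple a b c d e f g in
    Syntax.𝓛 (λ i → Syntax.Hankel⁺ 2 (λ j → t (i ℕ.+ j))) 0 := Syntax.Hankel⁺ 3 t :* Syntax.𝓛 t 2)
    refl (s 0) (s 1) (s 2) (s 3) (s 4) (s 5) (s 6)

  shiftBy : (ℕ → Carrier) → ℕ → (ℕ → Carrier)
  shiftBy s i j = s (j ℕ.+ i)

  𝓛-cong : ∀ {s t} → (∀ i → s i ≈ t i) → ∀ i → 𝓛 s i ≈ 𝓛 t i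
  𝓛-cong s≈t i = +-cong (*-cong (s≈t i) (s≈t (suc (suc i))))
    (-‿cong (*-cong (s≈t (suc i)) (s≈t (suc i))))

  -- A product rule, obtained by subtracting and adding s i * s (i + 2) * t (i + 1)². All minus
  -- signs end up inside 𝓛 s and 𝓛 t.
  𝓛-* : ∀ s t i → 𝓛 (λ j → s j * t j) i
    ≈ s i * s (suc (suc i)) * 𝓛 t i + 𝓛 s i * (t (suc i) * t (suc i))
  𝓛-* s t i = solve 6 (λ s₀ s₁ s₂ t₀ t₁ t₂ →
    s₀ :* t₀ :* (s₂ :* t₂) :- s₁ :* t₁ :* (s₁ :* t₁)
    := s₀ :* s₂ :* (t₀ :* t₂ :- t₁ :* t₁) :+ (s₀ :* s₂ :- s₁ :* s₁) :* (t₁ :* t₁))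
    refl (s i) (s (suc i)) (s (suc (suc i))) (t i) (t (suc i)) (t (suc (suc i)))

  module _ (s : ℕ → Carrier)
      (s-minors : ∀ k (r c : Fin k → ℕ) → StrictlyIncreasing r → StrictlyIncreasing c →
        Pos (det k (λ i j → s (r i ℕ.+ c j)))) where

    Hankel⁺≥0 : ∀ k i → Pos (Hankel⁺ k (shiftBy s i))
    Hankel⁺≥0 k i = Pos-resp
      (trans (det-cong (suc k) λ a b → reflexive (≡.cong s (≡.sym (ℕₚ.+-assoc (toℕ a) (toℕ b) i))))
             (det⁺-correct k λ a b → shiftBy s i (toℕ a ℕ.+ toℕ b)))
      (s-minors (suc k) toℕ (λ j → toℕ j ℕ.+ i) (λ _ _ a<b → a<b) (λ _ _ a<b → ℕₚ.+-monoˡ-< i a<b))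

    𝓛≥0 : ∀ i → Pos (𝓛 s i)
    𝓛≥0 = Hankel⁺≥0 1

    𝓛²-factor : ∀ i → 𝓛 (𝓛 s) i ≈ s (suc (suc i)) * Hankel⁺ 2 (shiftBy s i)
    𝓛²-factor i = dodgson₃ (shiftBy s i)

    𝓛²≥0 : ∀ i → Pos (𝓛 (𝓛 s) i)
    𝓛²≥0 i = Pos-resp (sym (𝓛²-factor i)) (Pos-* (Hankel⁺≥0 0 (suc (suc i))) (Hankel⁺≥0 2 i))

    -- The product rule separates the two factors of 𝓛², the entries s (i + 2) and the 3 × 3 minors
    -- `D i`; `dodgson₄` then condenses 𝓛 D.
    𝓛³≥0 : ∀ i → Pos (𝓛 (𝓛 (𝓛 s)) i)
    𝓛³≥0 i = Pos-resp
      (sym (begin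
        𝓛 (𝓛 (𝓛 s)) i
          ≈⟨ 𝓛-cong 𝓛²-factor i ⟩
        𝓛 (λ j → s (suc (suc j)) * D j) i
          ≈⟨ 𝓛-* (λ j → s (suc (suc j))) D i ⟩
        s (2 ℕ.+ i) * s (4 ℕ.+ i) * 𝓛 D i + 𝓛 s (2 ℕ.+ i) * (D (suc i) * D (suc i))
          ≈⟨ +-congʳ (*-congˡ (dodgson₄ (shiftBy s i))) ⟩
        s (2 ℕ.+ i) * s (4 ℕ.+ i) * (Hankel⁺ 3 (shiftBy s i) * 𝓛 s (2 ℕ.+ i))
          + 𝓛 s (2 ℕ.+ i) * (D (suc i) * D (suc i))
          ∎))
      (Pos-+
        (Pos-* (Pos-* (Hankel⁺≥0 0 (2 ℕ.+ i)) (Hankel⁺≥0 0 (4 ℕ.+ i)))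
               (Pos-* (Hankel⁺≥0 3 i) (𝓛≥0 (2 ℕ.+ i))))
        (Pos-* (𝓛≥0 (2 ℕ.+ i)) (Pos-* (Hankel⁺≥0 2 (suc i)) (Hankel⁺≥0 2 (suc i)))))
      where
      D : ℕ → Carrier
      D j = Hankel⁺ 2 (shiftBy s j)

-- Moments

record Scalars (R : CommutativeRing 0ℓ 0ℓ) : Set where
  open CommutativeRing R
  field
    ν : ℕ → Carrier
    ν-zero : ν 0 ≈ 0#
    ν-suc : ∀ n → ν (suc n) ≈ 1# + ν n

module Moments (R : CommutativeRing 0ℓ 0ℓ) (𝒩 : Scalars R) (a b c : CommutativeRing.Carrier R) where

  open CommutativeRing R hiding (zero)
  open Scalars 𝒩
  open import Algebra.Solver.Ring.NaturalCoefficients.Default commutativeSemiring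
  open import Relation.Binary.Reasoning.Setoid setoid

  e o : ℕ → Carrier
  e k = a + ν k * b
  o k = ν (suc k) * (c + b)

  open StieltjesTableau R e o

  -- binom(m, k) ∏_{k ≤ i < m} (a + i b), by its recurrence
  X : ℕ → ℕ → Carrier
  X zero    zero    = 1#
  X zero    (suc k) = 0#
  X (suc m) zero    = e m * X m 0
  X (suc m) (suc k) = X m k + (a + (ν (suc k) + ν m) * b) * X m (suc k)

  -- (k + 1) binom(m, k + 1) = (m − k) binom(m, k), without subtraction
  X-contiguous : ∀ m k → ν (suc k) * e k * X m (suc k) + ν k * X m k ≈ ν m * X m k
  X-contiguous zero zero = trans (+-congʳ (zeroʳ _)) (+-identityˡ _)
  X-contiguous zero (suc k) = begin
    ν (suc (suc k)) * e (suc k) * 0# + ν (suc k) * 0#  ≈⟨ +-cong (zeroʳ _) (zeroʳ _) ⟩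
    0# + 0#                                            ≈⟨ +-identityˡ 0# ⟩
    0#                                                 ≈⟨ zeroʳ (ν 0) ⟨
    ν 0 * 0#                                           ∎
  X-contiguous (suc m) zero = begin
    ν 1 * e 0 * (x + (a + (ν 1 + μ) * b) * w) + ν 0 * (e m * x)
      ≈⟨ +-cong
           (*-cong (*-cong ν1≈1 (+-congˡ (*-congʳ ν-zero)))
             (+-congˡ (*-congʳ (+-congˡ (*-congʳ (+-congʳ ν1≈1))))))
           (*-congʳ ν-zero) ⟩
    1# * (a + 0# * b) * (x + (a + (1# + μ) * b) * w) + 0# * (e m * x)
      ≈⟨ solve 5 (λ a b μ x w →
           con 1 :* (a :+ con 0 :* b) :* (x :+ (a :+ (con 1 :+ μ) :* b) :* w)
             :+ con 0 :* ((a :+ μ :* b) :* x)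
           := a :* x :+ (a :+ (con 1 :+ μ) :* b) :* (con 1 :* (a :+ con 0 :* b) :* w :+ con 0 :* x))
           refl a b μ x w ⟩
    a * x + (a + (1# + μ) * b) * (1# * (a + 0# * b) * w + 0# * x)
      ≈⟨ +-congˡ (*-congˡ (begin
           1# * (a + 0# * b) * w + 0# * x
             ≈⟨ +-cong (*-congʳ (*-cong ν1≈1 (+-congˡ (*-congʳ ν-zero)))) (*-congʳ ν-zero) ⟨
           ν 1 * e 0 * w + ν 0 * x
             ≈⟨ X-contiguous m 0 ⟩
           μ * x
             ∎)) ⟩
    a * x + (a + (1# + μ) * b) * (μ * x)
      ≈⟨ solve 4 (λ a b μ x →
           a :* x :+ (a :+ (con 1 :+ μ) :* b) :* (μ :* x) := (con 1 :+ μ) :* ((a :+ μ :* b) :* x))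
           refl a b μ x ⟩
    (1# + μ) * (e m * x)
      ≈⟨ *-congʳ (ν-suc m) ⟨
    ν (suc m) * (e m * x)
      ∎
    where
    μ = ν m
    x = X m 0
    w = X m 1
    ν1≈1 : ν 1 ≈ 1#
    ν1≈1 = trans (ν-suc 0) (trans (+-congˡ ν-zero) (+-identityʳ 1#))
  X-contiguous (suc m) (suc k) = begin
    ν (suc (suc k)) * e (suc k) * (x + (a + (ν (suc (suc k)) + μ) * b) * w)
      + ν (suc k) * (y + (a + (ν (suc k) + μ) * b) * x)
      ≈⟨ +-cong
          (*-cong (*-cong ν₂ (+-congˡ (*-congʳ ν₁))) (+-congˡ (*-congʳ (+-congˡ (*-congʳ (+-congʳ ν₂))))))
          (*-cong ν₁ (+-congˡ (*-congʳ (+-congˡ (*-congʳ (+-congʳ ν₁)))))) ⟩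
    κ₂ * (a + κ₁ * b) * (x + (a + (κ₂ + μ) * b) * w) + κ₁ * (y + (a + (κ₁ + μ) * b) * x)
      -- The expression is regrouped around `J` and `I`, the left sides of the identity at (m, k)
      -- and (m, k + 1), so that both induction hypotheses apply.
      ≈⟨ solve 7 (λ a b κ μ x y w →
           let κ₁ = con 1 :+ κ
               κ₂ = con 1 :+ κ₁
               I = κ₂ :* (a :+ κ₁ :* b) :* w :+ κ₁ :* x
               J = κ₁ :* (a :+ κ :* b) :* x :+ κ :* y
           in κ₂ :* (a :+ κ₁ :* b) :* (x :+ (a :+ (κ₂ :+ μ) :* b) :* w)
                :+ κ₁ :* (y :+ (a :+ (κ₁ :+ μ) :* b) :* x)
              := J :+ (y :+ (a :+ κ₁ :* b) :* x :+ b :* I :+ (a :+ (κ₁ :+ μ) :* b) :* I))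
           refl a b κ μ x y w ⟩
    J + (y + (a + κ₁ * b) * x + b * I + (a + (κ₁ + μ) * b) * I)
      ≈⟨ +-cong J≈ (+-cong (+-congˡ (*-congˡ I≈)) (*-congˡ I≈)) ⟩
    μ * y + (y + (a + κ₁ * b) * x + b * (μ * x) + (a + (κ₁ + μ) * b) * (μ * x))
      ≈⟨ solve 6 (λ a b κ μ x y →
           let κ₁ = con 1 :+ κ
           in μ :* y :+ (y :+ (a :+ κ₁ :* b) :* x :+ b :* (μ :* x) :+ (a :+ (κ₁ :+ μ) :* b) :* (μ :* x))
              := (con 1 :+ μ) :* (y :+ (a :+ (κ₁ :+ μ) :* b) :* x))
           refl a b κ μ x y ⟩
    (1# + μ) * (y + (a + (κ₁ + μ) * b) * x)
      ≈⟨ *-cong (ν-suc m) (+-congˡ (*-congʳ (+-congˡ (*-congʳ (+-congʳ ν₁))))) ⟨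
    ν (suc m) * (y + (a + (ν (suc k) + μ) * b) * x)
      ∎
    where
    κ = ν k
    κ₁ = 1# + κ
    κ₂ = 1# + κ₁
    μ = ν m
    y = X m k
    x = X m (suc k)
    w = X m (suc (suc k))
    I = κ₂ * (a + κ₁ * b) * w + κ₁ * x
    J = κ₁ * (a + κ * b) * x + κ * y
    ν₁ : ν (suc k) ≈ κ₁
    ν₁ = ν-suc k
    ν₂ : ν (suc (suc k)) ≈ κ₂
    ν₂ = trans (ν-suc (suc k)) (+-congˡ ν₁)
    I≈ : I ≈ μ * x
    I≈ = trans (sym (+-cong (*-congʳ (*-cong ν₂ (+-congˡ (*-congʳ ν₁)))) (*-congʳ ν₁)))
               (X-contiguous m (suc k))
    J≈ : J ≈ μ * y
    J≈ = trans (sym (+-congʳ (*-congʳ (*-congʳ ν₁)))) (X-contiguous m k)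

  -- Σₙ S(m, n) c^(m−n) φ(n), by the recurrence of the Stirling numbers
  stirlingSum : ℕ → (ℕ → Carrier) → Carrier
  stirlingSum zero    φ = φ 0
  stirlingSum (suc m) φ = stirlingSum m λ n → φ (suc n) + c * ν n * φ n

  stirlingSum-cong : ∀ m {φ ψ} → (∀ n → φ n ≈ ψ n) → stirlingSum m φ ≈ stirlingSum m ψ
  stirlingSum-cong zero    φ≈ψ = φ≈ψ 0
  stirlingSum-cong (suc m) φ≈ψ = stirlingSum-cong m λ n → +-cong (φ≈ψ (suc n)) (*-congˡ (φ≈ψ n))

  stirlingSum-+ : ∀ m φ ψ → stirlingSum m (λ n → φ n + ψ n) ≈ stirlingSum m φ + stirlingSum m ψ
  stirlingSum-+ zero    φ ψ = refl
  stirlingSum-+ (suc m) φ ψ = trans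
    (stirlingSum-cong m λ n → solve 5 (λ f g k f′ g′ →
      (f′ :+ g′) :+ k :* (f :+ g) := (f′ :+ k :* f) :+ (g′ :+ k :* g))
      refl (φ n) (ψ n) (c * ν n) (φ (suc n)) (ψ (suc n)))
    (stirlingSum-+ m _ _)

  stirlingSum-* : ∀ m x φ → stirlingSum m (λ n → x * φ n) ≈ x * stirlingSum m φ
  stirlingSum-* zero    x φ = refl
  stirlingSum-* (suc m) x φ = trans
    (stirlingSum-cong m λ n → solve 4 (λ x f k f′ → x :* f′ :+ k :* (x :* f) := x :* (f′ :+ k :* f))
      refl x (φ n) (c * ν n) (φ (suc n)))
    (stirlingSum-* m x _)

  X′ : ℕ → ℕ → Carrier
  X′ m k = X m k + o k * X m (suc k)

  -- Collecting the factor c + b exposes the left side of `X-contiguous`, which becomes ν m * x. Its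
  -- b part completes the factor of the next product, and its c part is the Stirling term.
  X-step-0 : ∀ m → X (suc m) 0 + c * ν m * X m 0 ≈ e 0 * X′ m 0
  X-step-0 m = sym (begin
    e 0 * (x + ν 1 * (c + b) * w)
      ≈⟨ +-cong-e₀ ⟩
    e₀ * (x + ν 1 * (c + b) * w)
      ≈⟨ solve 6 (λ a b c ν₁ x w → (a :+ con 0 :* b) :* (x :+ ν₁ :* (c :+ b) :* w)
           := a :* x :+ (c :+ b) :* (ν₁ :* (a :+ con 0 :* b) :* w :+ con 0 :* x))
           refl a b c (ν 1) x w ⟩
    a * x + (c + b) * (ν 1 * e₀ * w + 0# * x)
      ≈⟨ +-congˡ (*-congˡ (trans
           (sym (+-cong (*-congʳ (*-congˡ (+-congˡ (*-congʳ ν-zero)))) (*-congʳ ν-zero)))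
           (X-contiguous m 0))) ⟩
    a * x + (c + b) * (ν m * x)
      ≈⟨ solve 5 (λ a b c μ x → a :* x :+ (c :+ b) :* (μ :* x) := (a :+ μ :* b) :* x :+ c :* μ :* x)
           refl a b c (ν m) x ⟩
    e m * x + c * ν m * x
      ∎)
    where
    x = X m 0
    w = X m 1
    e₀ = a + 0# * b
    +-cong-e₀ : e 0 * (x + ν 1 * (c + b) * w) ≈ e₀ * (x + ν 1 * (c + b) * w)
    +-cong-e₀ = *-congʳ (+-congˡ (*-congʳ ν-zero))

  X-step-suc : ∀ m k → X (suc m) (suc k) + c * ν m * X m (suc k)
    ≈ X′ m k + e (suc k) * X′ m (suc k)
  X-step-suc m k = sym (begin
    (y + κ₁ * (c + b) * x) + (a + κ₁ * b) * (x + κ₂ * (c + b) * w)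
      ≈⟨ solve 8 (λ a b c κ₁ κ₂ x y w →
           (y :+ κ₁ :* (c :+ b) :* x) :+ (a :+ κ₁ :* b) :* (x :+ κ₂ :* (c :+ b) :* w)
           := y :+ (a :+ κ₁ :* b) :* x :+ (c :+ b) :* (κ₂ :* (a :+ κ₁ :* b) :* w :+ κ₁ :* x))
           refl a b c κ₁ κ₂ x y w ⟩
    y + (a + κ₁ * b) * x + (c + b) * (κ₂ * (a + κ₁ * b) * w + κ₁ * x)
      ≈⟨ +-congˡ (*-congˡ (X-contiguous m (suc k))) ⟩
    y + (a + κ₁ * b) * x + (c + b) * (ν m * x)
      ≈⟨ solve 7 (λ a b c κ₁ μ x y →
           y :+ (a :+ κ₁ :* b) :* x :+ (c :+ b) :* (μ :* x)
           := y :+ (a :+ (κ₁ :+ μ) :* b) :* x :+ c :* μ :* x)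
           refl a b c κ₁ (ν m) x y ⟩
    y + (a + (κ₁ + ν m) * b) * x + c * ν m * x
      ∎)
    where
    κ₁ = ν (suc k)
    κ₂ = ν (suc (suc k))
    y = X m k
    x = X m (suc k)
    w = X m (suc (suc k))

  mutual
    -- `stirlingSum n` is linear, so the identities `X-step-0` and `X-step-suc` pass through it and
    -- become the recurrence of `L`.
    stirlingSum-X : ∀ n k → stirlingSum n (λ m → X m k) ≈ L n k
    stirlingSum-X zero    zero    = refl
    stirlingSum-X zero    (suc k) = refl
    stirlingSum-X (suc n) zero    = begin
      stirlingSum n (λ m → X (suc m) 0 + c * ν m * X m 0)  ≈⟨ stirlingSum-cong n X-step-0 ⟩
      stirlingSum n (λ m → e 0 * X′ m 0)                   ≈⟨ stirlingSum-* n (e 0) (λ m → X′ m 0) ⟩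
      e 0 * stirlingSum n (λ m → X′ m 0)                   ≈⟨ *-congˡ (stirlingSum-X′ n 0) ⟩
      e 0 * L′ n 0                                         ∎
    stirlingSum-X (suc n) (suc k) = begin
      stirlingSum n (λ m → X (suc m) (suc k) + c * ν m * X m (suc k))
        ≈⟨ stirlingSum-cong n (λ m → X-step-suc m k) ⟩
      stirlingSum n (λ m → X′ m k + e (suc k) * X′ m (suc k))
        ≈⟨ stirlingSum-+ n (λ m → X′ m k) (λ m → e (suc k) * X′ m (suc k)) ⟩
      stirlingSum n (λ m → X′ m k) + stirlingSum n (λ m → e (suc k) * X′ m (suc k))
        ≈⟨ +-cong (stirlingSum-X′ n k)
             (trans (stirlingSum-* n (e (suc k)) (λ m → X′ m (suc k))) (*-congˡ (stirlingSum-X′ n (suc k)))) ⟩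
      L′ n k + e (suc k) * L′ n (suc k)
        ∎

    stirlingSum-X′ : ∀ n k → stirlingSum n (λ m → X′ m k) ≈ L′ n k
    stirlingSum-X′ n k = trans (stirlingSum-+ n (λ m → X m k) (λ m → o k * X m (suc k)))
      (+-cong (stirlingSum-X n k)
        (trans (stirlingSum-* n (o k) (λ m → X m (suc k))) (*-congˡ (stirlingSum-X n (suc k)))))

  -- S(m, n) c^(m−n)
  stirling : ℕ → ℕ → Carrier
  stirling zero    zero    = 1#
  stirling zero    (suc n) = 0#
  stirling (suc m) zero    = 0#
  stirling (suc m) (suc n) = stirling m n + c * ν (suc n) * stirling m (suc n)

  -- The recurrence that `extended-suc` will impose on the coefficients of the terms of the defining
  -- series.
  stirling-X-suc : ∀ m n →
    e n * (stirling m n * X n 0) + ν (suc n) * c * (stirling m (suc n) * X (suc n) 0)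
    ≈ stirling (suc m) (suc n) * X (suc n) 0
  stirling-X-suc m n = solve 6 (λ e x s s′ v c →
    e :* (s :* x) :+ v :* c :* (s′ :* (e :* x)) := (s :+ c :* v :* s′) :* (e :* x))
    refl (e n) (X n 0) (stirling m n) (stirling m (suc n)) (ν (suc n)) c

  module _ (S : Summation R) where

    open Summation S
    open FiniteSums R S

    -- Summation by parts moves the Stirling recurrence from the coefficients onto φ. The bound `N`
    -- may exceed `m` because one of the two recursive sums keeps its length while `m` drops.
    Σ-stirling : ∀ m N → m ℕ.≤ N → ∀ φ → Σ N (λ n → stirling m n * φ n) ≈ stirlingSum m φ
    Σ-stirling zero zero _ φ = trans (Σ-zero _) (*-identityˡ (φ 0))
    Σ-stirling zero (suc N) _ φ = begin
      Σ (suc N) (λ n → stirling 0 n * φ n)        ≈⟨ Σ-head N _ ⟩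
      1# * φ 0 + Σ N (λ n → 0# * φ (suc n))       ≈⟨ +-cong (*-identityˡ (φ 0)) (Σ-0 N λ n _ → zeroˡ (φ (suc n))) ⟩
      φ 0 + 0#                                    ≈⟨ +-identityʳ (φ 0) ⟩
      φ 0                                         ∎
    Σ-stirling (suc m) (suc N) (s≤s m≤N) φ = begin
      Σ (suc N) (λ n → stirling (suc m) n * φ n)
        ≈⟨ Σ-head N _ ⟩
      0# * φ 0 + Σ N (λ n → (stirling m n + c * ν (suc n) * stirling m (suc n)) * φ (suc n))
        ≈⟨ +-cong (zeroˡ (φ 0)) (Σ-cong N λ n →
             solve 5 (λ s k v s′ f → (s :+ k :* v :* s′) :* f := s :* f :+ s′ :* (k :* v :* f)) refl
               (stirling m n) c (ν (suc n)) (stirling m (suc n)) (φ (suc n))) ⟩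
      0# + Σ N (λ n → stirling m n * φ (suc n) + stirling m (suc n) * ψ (suc n))
        ≈⟨ +-congˡ (Σ-+ N _ _) ⟩
      0# + (Σ N (λ n → stirling m n * φ (suc n)) + Σ N (λ n → stirling m (suc n) * ψ (suc n)))
        ≈⟨ solve 2 (λ x y → con 0 :+ (x :+ y) := x :+ (con 0 :+ y)) refl _ _ ⟩
      Σ N (λ n → stirling m n * φ (suc n)) + (0# + Σ N (λ n → stirling m (suc n) * ψ (suc n)))
        -- The term n = 0 is restored to the second sum; it is zero because ν 0 is.
        ≈⟨ +-congˡ (+-congʳ (trans (*-congˡ (trans (*-congʳ (trans (*-congˡ ν-zero) (zeroʳ c))) (zeroˡ (φ 0)))) (zeroʳ (stirling m 0)))) ⟨
      Σ N (λ n → stirling m n * φ (suc n)) + (stirling m 0 * ψ 0 + Σ N (λ n → stirling m (suc n) * ψ (suc n)))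
        ≈⟨ +-congˡ (Σ-head N (λ n → stirling m n * ψ n)) ⟨
      Σ N (λ n → stirling m n * φ (suc n)) + Σ (suc N) (λ n → stirling m n * ψ n)
        ≈⟨ +-cong (Σ-stirling m N m≤N (λ n → φ (suc n))) (Σ-stirling m (suc N) (ℕₚ.m≤n⇒m≤1+n m≤N) ψ) ⟩
      stirlingSum m (λ n → φ (suc n)) + stirlingSum m ψ
        ≈⟨ stirlingSum-+ m (λ n → φ (suc n)) ψ ⟨
      stirlingSum m (λ n → φ (suc n) + ψ n)
        ∎
      where
      ψ : ℕ → Carrier
      ψ n = c * ν n * φ n

    Σ-stirling-X : ∀ m N → m ℕ.≤ N → Σ N (λ n → stirling m n * X n 0) ≈ L m 0
    Σ-stirling-X m N m≤N = trans (Σ-stirling m N m≤N (λ n → X n 0)) (stirlingSum-X m 0)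

-- Continued fractions

-- The defining equations of zTimes, constS, powS and invOneMinusZ, so that
-- they can be reasoned about over an abstract coefficient ring.
record SeriesOperations (R : CommutativeRing 0ℓ 0ℓ) (S : Summation R) (U : UnitSeries R) : Set where
  open CommutativeRing R
  open Summation S
  open UnitSeries U
  open PowerSeries R S U
  field
    shiftUp : Series → Series
    shiftUp-zero : ∀ F → shiftUp F 0 ≈ 0#
    shiftUp-suc : ∀ F m → shiftUp F (suc m) ≈ F m
    const : Carrier → Series
    const-zero : ∀ x → const x 0 ≈ x
    const-suc : ∀ x m → const x (suc m) ≈ 0#
    pow : Series → ℕ → Series
    pow-zero : ∀ F m → pow F 0 m ≈ 𝟙 m
    pow-suc : ∀ F k m → pow F (suc k) m ≈ (pow F k ⊛ F) m
    inv : Series → Series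
    inv-def : ∀ H m → inv H m ≈ Σ m (λ k → pow (shiftUp H) k m)

module SeriesInverse (R : CommutativeRing 0ℓ 0ℓ) (S : Summation R) (U : UnitSeries R)
    (O : SeriesOperations R S U) where

  open CommutativeRing R hiding (zero)
  open Summation S
  open UnitSeries U
  open PowerSeries R S U
  open SeriesOperations O
  open FiniteSums R S
  open import Algebra.Properties.AbelianGroup +-abelianGroup using (∙-cancelʳ)
  open import Relation.Binary.Reasoning.Setoid setoid

  infix 4 _≈[_]_
  -- Congruence modulo z^n, the sense in which a convergent approximates its limit.
  _≈[_]_ : Series → ℕ → Series → Set
  F ≈[ n ] G = ∀ m → m ℕ.< n → F m ≈ G m

  ⊛-congˡ-≈[] : ∀ {n} F {G G′} → G ≈[ n ] G′ → F ⊛ G ≈[ n ] F ⊛ G′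
  ⊛-congˡ-≈[] F G≈G′ m m<n = Σ-cong m λ t → *-congˡ (G≈G′ (m ∸ t) (ℕₚ.≤-<-trans (ℕₚ.m∸n≤m m t) m<n))

  const-⊛ : ∀ x F m → (const x ⊛ F) m ≈ x * F m
  const-⊛ x F zero = trans (⊛-zero (const x) F) (*-congʳ (const-zero x))
  const-⊛ x F (suc m) = begin
    (const x ⊛ F) (suc m)                                ≈⟨ ⊛-head (const x) F m ⟩
    const x 0 * F (suc m) + (shift (const x) ⊛ F) m      ≈⟨ +-cong (*-congʳ (const-zero x))
                                                              (Σ-0 m λ t _ → trans (*-congʳ (const-suc x t)) (zeroˡ _)) ⟩
    x * F (suc m) + 0#                                   ≈⟨ +-identityʳ _ ⟩
    x * F (suc m)                                        ∎

  shiftUp-cong : ∀ {F G} → (∀ m → F m ≈ G m) → ∀ m → shiftUp F m ≈ shiftUp G m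
  shiftUp-cong {F} {G} F≈G zero    = trans (shiftUp-zero F) (sym (shiftUp-zero G))
  shiftUp-cong {F} {G} F≈G (suc m) = trans (shiftUp-suc F m) (trans (F≈G m) (sym (shiftUp-suc G m)))

  ⊛-shiftUp : ∀ F G m → (F ⊛ shiftUp G) m ≈ shiftUp (F ⊛ G) m
  ⊛-shiftUp F G zero = begin
    (F ⊛ shiftUp G) 0    ≈⟨ ⊛-zero F (shiftUp G) ⟩
    F 0 * shiftUp G 0    ≈⟨ *-congˡ (shiftUp-zero G) ⟩
    F 0 * 0#             ≈⟨ zeroʳ (F 0) ⟩
    0#                   ≈⟨ shiftUp-zero (F ⊛ G) ⟨
    shiftUp (F ⊛ G) 0    ∎
  ⊛-shiftUp F G (suc m) = begin
    (F ⊛ shiftUp G) (suc m)                                    ≈⟨ ⊛-last F (shiftUp G) m ⟩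
    (F ⊛ shift (shiftUp G)) m + F (suc m) * shiftUp G 0        ≈⟨ +-cong
                                                                    (Σ-cong m λ t → *-congˡ (shiftUp-suc G (m ∸ t)))
                                                                    (trans (*-congˡ (shiftUp-zero G)) (zeroʳ _)) ⟩
    (F ⊛ G) m + 0#                                             ≈⟨ +-identityʳ _ ⟩
    (F ⊛ G) m                                                  ≈⟨ shiftUp-suc (F ⊛ G) m ⟨
    shiftUp (F ⊛ G) (suc m)                                    ∎

  shiftUp-⊛ : ∀ F G m → (shiftUp F ⊛ G) m ≈ shiftUp (F ⊛ G) m
  shiftUp-⊛ F G m = begin
    (shiftUp F ⊛ G) m    ≈⟨ ⊛-comm (shiftUp F) G m ⟩
    (G ⊛ shiftUp F) m    ≈⟨ ⊛-shiftUp G F m ⟩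
    shiftUp (G ⊛ F) m    ≈⟨ shiftUp-cong (⊛-comm G F) m ⟩
    shiftUp (F ⊛ G) m    ∎

  pow-shiftUp : ∀ H k m → pow (shiftUp H) (suc k) (suc m) ≈ (pow (shiftUp H) k ⊛ H) m
  pow-shiftUp H k m = begin
    pow (shiftUp H) (suc k) (suc m)          ≈⟨ pow-suc (shiftUp H) k (suc m) ⟩
    (pow (shiftUp H) k ⊛ shiftUp H) (suc m)  ≈⟨ ⊛-shiftUp _ H (suc m) ⟩
    shiftUp (pow (shiftUp H) k ⊛ H) (suc m)  ≈⟨ shiftUp-suc _ m ⟩
    (pow (shiftUp H) k ⊛ H) m                ∎

  pow-shiftUp-vanish : ∀ H k m → m ℕ.< k → pow (shiftUp H) k m ≈ 0#
  pow-shiftUp-vanish H (suc k) zero _ =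
    trans (pow-suc (shiftUp H) k 0) (trans (⊛-shiftUp _ H 0) (shiftUp-zero _))
  pow-shiftUp-vanish H (suc k) (suc m) (s≤s m<k) = trans (pow-shiftUp H k m)
    (Σ-0 m λ t t≤m → trans (*-congʳ (pow-shiftUp-vanish H k t (ℕₚ.≤-<-trans t≤m m<k))) (zeroˡ _))

  -- In `inv` the number of summands grows with the coefficient index. A fixed cutoff gives a finite
  -- sum of series, which can be multiplied term by term.
  geometricSum : Series → ℕ → Series
  geometricSum H N m = Σ N λ k → pow (shiftUp H) k m

  geometricSum-stable : ∀ H N m → m ℕ.≤ N → geometricSum H N m ≈ inv H m
  geometricSum-stable H N m m≤N with ℕₚ.m≤n⇒m<n∨m≡n m≤N
  ... | inj₂ ≡.refl = sym (inv-def H m)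
  geometricSum-stable H (suc N) m m≤N | inj₁ (s≤s m≤N′) = begin
    geometricSum H (suc N) m                              ≈⟨ Σ-suc N _ ⟩
    geometricSum H N m + pow (shiftUp H) (suc N) m        ≈⟨ +-cong (geometricSum-stable H N m m≤N′)
                                                               (pow-shiftUp-vanish H (suc N) m (s≤s m≤N′)) ⟩
    inv H m + 0#                                          ≈⟨ +-identityʳ _ ⟩
    inv H m                                               ∎

  geometricSum-⊛ : ∀ H N F m → (geometricSum H N ⊛ F) m ≈ Σ N (λ k → (pow (shiftUp H) k ⊛ F) m)
  geometricSum-⊛ H zero    F m = begin
    (geometricSum H 0 ⊛ F) m                 ≈⟨ Σ-cong m (λ t → *-congʳ (Σ-zero _)) ⟩
    (pow (shiftUp H) 0 ⊛ F) m                ≈⟨ Σ-zero (λ k → (pow (shiftUp H) k ⊛ F) m) ⟨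
    Σ 0 (λ k → (pow (shiftUp H) k ⊛ F) m)    ∎
  geometricSum-⊛ H (suc N) F m = begin
    (geometricSum H (suc N) ⊛ F) m
      ≈⟨ Σ-cong m (λ t → *-congʳ (Σ-suc N _)) ⟩
    ((λ t → geometricSum H N t + pow (shiftUp H) (suc N) t) ⊛ F) m
      ≈⟨ ⊛-distribʳ F (geometricSum H N) (pow (shiftUp H) (suc N)) m ⟩
    (geometricSum H N ⊛ F) m + (pow (shiftUp H) (suc N) ⊛ F) m
      ≈⟨ +-congʳ (geometricSum-⊛ H N F m) ⟩
    Σ N (λ k → (pow (shiftUp H) k ⊛ F) m) + (pow (shiftUp H) (suc N) ⊛ F) m
      ≈⟨ Σ-suc N (λ k → (pow (shiftUp H) k ⊛ F) m) ⟨
    Σ (suc N) (λ k → (pow (shiftUp H) k ⊛ F) m)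
      ∎

  inv-unfold : ∀ H m → inv H m ≈ 𝟙 m + shiftUp (inv H ⊛ H) m
  inv-unfold H zero = begin
    inv H 0                              ≈⟨ inv-def H 0 ⟩
    Σ 0 (λ k → pow (shiftUp H) k 0)      ≈⟨ Σ-zero _ ⟩
    pow (shiftUp H) 0 0                  ≈⟨ pow-zero (shiftUp H) 0 ⟩
    𝟙 0                                  ≈⟨ +-identityʳ _ ⟨
    𝟙 0 + 0#                             ≈⟨ +-congˡ (shiftUp-zero _) ⟨
    𝟙 0 + shiftUp (inv H ⊛ H) 0          ∎
  inv-unfold H (suc m) = begin
    inv H (suc m)
      ≈⟨ inv-def H (suc m) ⟩
    Σ (suc m) (λ k → pow (shiftUp H) k (suc m))
      ≈⟨ Σ-head m (λ k → pow (shiftUp H) k (suc m)) ⟩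
    pow (shiftUp H) 0 (suc m) + Σ m (λ k → pow (shiftUp H) (suc k) (suc m))
      ≈⟨ +-cong (pow-zero (shiftUp H) (suc m)) (Σ-cong m λ k → pow-shiftUp H k m) ⟩
    𝟙 (suc m) + Σ m (λ k → (pow (shiftUp H) k ⊛ H) m)
      ≈⟨ +-congˡ (geometricSum-⊛ H m H m) ⟨
    𝟙 (suc m) + (geometricSum H m ⊛ H) m
      ≈⟨ +-congˡ (Σ-cong-≤ m λ t t≤m → *-congʳ (geometricSum-stable H m t t≤m)) ⟩
    𝟙 (suc m) + (inv H ⊛ H) m
      ≈⟨ +-congˡ (shiftUp-suc (inv H ⊛ H) m) ⟨
    𝟙 (suc m) + shiftUp (inv H ⊛ H) (suc m)
      ∎

  inv-⊛ : ∀ H F m → (inv H ⊛ F) m ≈ F m + shiftUp (inv H ⊛ (H ⊛ F)) m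
  inv-⊛ H F m = begin
    (inv H ⊛ F) m
      ≈⟨ Σ-cong m (λ t → *-congʳ (inv-unfold H t)) ⟩
    ((λ t → 𝟙 t + shiftUp (inv H ⊛ H) t) ⊛ F) m
      ≈⟨ ⊛-distribʳ F 𝟙 (shiftUp (inv H ⊛ H)) m ⟩
    (𝟙 ⊛ F) m + (shiftUp (inv H ⊛ H) ⊛ F) m
      ≈⟨ +-cong (⊛-identityˡ F m) (shiftUp-⊛ (inv H ⊛ H) F m) ⟩
    F m + shiftUp ((inv H ⊛ H) ⊛ F) m
      ≈⟨ +-congˡ (shiftUp-cong (⊛-assoc (inv H) H F) m) ⟩
    F m + shiftUp (inv H ⊛ (H ⊛ F)) m
      ∎

  -- The hypothesis says that g₋ is (1 - zH) g modulo z^n. After multiplication by `inv H` and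
  -- expansion of `inv H ⊛ g`, the same term stands on both sides and cancels.
  inv-solves : ∀ n H g₋ g → (λ m → g₋ m + shiftUp (H ⊛ g) m) ≈[ n ] g → inv H ⊛ g₋ ≈[ n ] g
  inv-solves n H g₋ g g≈ m m<n = ∙-cancelʳ (shiftUp (inv H ⊛ (H ⊛ g)) m) _ _ (begin
    (inv H ⊛ g₋) m + shiftUp (inv H ⊛ (H ⊛ g)) m
      ≈⟨ +-cong (⊛-comm (inv H) g₋ m)
           (trans (sym (⊛-shiftUp (inv H) (H ⊛ g) m)) (⊛-comm (inv H) (shiftUp (H ⊛ g)) m)) ⟩
    (g₋ ⊛ inv H) m + (shiftUp (H ⊛ g) ⊛ inv H) m
      ≈⟨ ⊛-distribʳ (inv H) g₋ (shiftUp (H ⊛ g)) m ⟨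
    ((λ t → g₋ t + shiftUp (H ⊛ g) t) ⊛ inv H) m
      ≈⟨ ⊛-comm _ (inv H) m ⟩
    (inv H ⊛ (λ t → g₋ t + shiftUp (H ⊛ g) t)) m
      ≈⟨ ⊛-congˡ-≈[] (inv H) g≈ m m<n ⟩
    (inv H ⊛ g) m
      ≈⟨ inv-⊛ H g m ⟩
    g m + shiftUp (inv H ⊛ (H ⊛ g)) m
      ∎)

-- Euler's method: if g₀ = 1 and gⱼ₊₁ = gⱼ + z Hⱼ gⱼ₊₁, where Hⱼ involves
-- gⱼ₊₂ / gⱼ₊₁, then the j-th tail of the continued fraction is gⱼ₊₁ / gⱼ.
module ContinuedFractions (R : CommutativeRing 0ℓ 0ℓ) (S : Summation R) (U : UnitSeries R)
    (O : SeriesOperations R S U) where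

  open CommutativeRing R hiding (zero)
  open Summation S
  open UnitSeries U
  open PowerSeries R S U
  open SeriesOperations O
  open SeriesInverse R S U O
  open FiniteSums R S
  open import Relation.Binary.Reasoning.Setoid setoid

  module _
      (frac H : ℕ → ℕ → Series)
      (frac-zero : ∀ j m → frac 0 j m ≈ 𝟙 m)
      (frac-suc : ∀ N j m → frac (suc N) j m ≈ inv (H N j) m)
      (g : ℕ → Series)
      (g-zero : ∀ j → g j 0 ≈ 1#)
      (g-suc : ∀ N j → frac N (suc j) ⊛ g (suc j) ≈[ suc N ] g (suc (suc j)) →
        (λ m → g j (suc m) + (H N j ⊛ g (suc j)) m) ≈[ suc N ] shift (g (suc j)))
    where

    -- The tail enters each level with a factor z, so every level gains one order of agreement;
    -- `frac 0` supplies only the constant term.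
    frac-⊛ : ∀ N j → frac N j ⊛ g j ≈[ suc N ] g (suc j)
    frac-⊛ zero j zero _ = begin
      (frac 0 j ⊛ g j) 0    ≈⟨ ⊛-zero (frac 0 j) (g j) ⟩
      frac 0 j 0 * g j 0    ≈⟨ *-cong (trans (frac-zero j 0) 𝟙-zero) (g-zero j) ⟩
      1# * 1#               ≈⟨ *-identityˡ 1# ⟩
      1#                    ≈⟨ g-zero (suc j) ⟨
      g (suc j) 0           ∎
    frac-⊛ zero j (suc m) (s≤s ())
    frac-⊛ (suc N) j m m<2+N = begin
      (frac (suc N) j ⊛ g j) m    ≈⟨ Σ-cong m (λ t → *-congʳ (frac-suc N j t)) ⟩
      (inv (H N j) ⊛ g j) m       ≈⟨ inv-solves (suc (suc N)) (H N j) (g j) (g (suc j)) step m m<2+N ⟩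
      g (suc j) m                 ∎
      where
      step : (λ m → g j m + shiftUp (H N j ⊛ g (suc j)) m) ≈[ suc (suc N) ] g (suc j)
      step zero _ = begin
        g j 0 + shiftUp (H N j ⊛ g (suc j)) 0    ≈⟨ +-cong (g-zero j) (shiftUp-zero _) ⟩
        1# + 0#                                  ≈⟨ +-identityʳ 1# ⟩
        1#                                       ≈⟨ g-zero (suc j) ⟨
        g (suc j) 0                              ∎
      step (suc m) (s≤s m<1+N) = trans (+-congˡ (shiftUp-suc _ m)) (g-suc N j (frac-⊛ N (suc j)) m m<1+N)

    frac-coefficient : (∀ m → g 0 m ≈ 𝟙 m) → ∀ N m → m ℕ.≤ N → frac N 0 m ≈ g 1 m
    frac-coefficient g₀≈𝟙 N m m≤N = begin
      frac N 0 m              ≈⟨ ⊛-identityˡ (frac N 0) m ⟨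
      (𝟙 ⊛ frac N 0) m        ≈⟨ ⊛-comm 𝟙 (frac N 0) m ⟩
      (frac N 0 ⊛ 𝟙) m        ≈⟨ Σ-cong m (λ t → *-congˡ (sym (g₀≈𝟙 (m ∸ t)))) ⟩
      (frac N 0 ⊛ g 0) m      ≈⟨ frac-⊛ N 0 m (s≤s m≤N) ⟩
      g 1 m                   ∎

  sfrac-coefficient : ∀ (frac : ℕ → ℕ → Series) (α : ℕ → Carrier) →
    (∀ j m → frac 0 j m ≈ 𝟙 m) →
    (∀ N j m → frac (suc N) j m ≈ inv (const (α j) ⊛ frac N (suc j)) m) →
    (g : ℕ → Series) →
    (∀ j → g j 0 ≈ 1#) →
    (∀ j m → g j (suc m) + α j * g (suc (suc j)) m ≈ g (suc j) (suc m)) →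
    (∀ m → g 0 m ≈ 𝟙 m) →
    ∀ N m → m ℕ.≤ N → frac N 0 m ≈ g 1 m
  sfrac-coefficient frac α frac-zero frac-suc g g-zero g-suc =
    frac-coefficient frac (λ N j → const (α j) ⊛ frac N (suc j)) frac-zero frac-suc g g-zero
      λ N j tail m m<1+N → begin
        g j (suc m) + (const (α j) ⊛ frac N (suc j) ⊛ g (suc j)) m
          ≈⟨ +-congˡ (⊛-assoc (const (α j)) (frac N (suc j)) (g (suc j)) m) ⟩
        g j (suc m) + (const (α j) ⊛ (frac N (suc j) ⊛ g (suc j))) m
          ≈⟨ +-congˡ (const-⊛ (α j) (frac N (suc j) ⊛ g (suc j)) m) ⟩
        g j (suc m) + α j * (frac N (suc j) ⊛ g (suc j)) m
          ≈⟨ +-congˡ (*-congˡ (tail m m<1+N)) ⟩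
        g j (suc m) + α j * g (suc (suc j)) m
          ≈⟨ g-suc j m ⟩
        g (suc j) (suc m)
          ∎

  jfrac-coefficient : ∀ (frac : ℕ → ℕ → Series) (γ δ : ℕ → Carrier) →
    (∀ j m → frac 0 j m ≈ 𝟙 m) →
    (∀ N j m → frac (suc N) j m ≈ inv (λ t → const (γ j) t + shiftUp (const (δ j) ⊛ frac N (suc j)) t) m) →
    (g : ℕ → Series) →
    (∀ j → g j 0 ≈ 1#) →
    (∀ j m → g j (suc m) + (γ j * g (suc j) m + δ j * shiftUp (g (suc (suc j))) m) ≈ g (suc j) (suc m)) →
    (∀ m → g 0 m ≈ 𝟙 m) →
    ∀ N m → m ℕ.≤ N → frac N 0 m ≈ g 1 m
  jfrac-coefficient frac γ δ frac-zero frac-suc g g-zero g-suc =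
    frac-coefficient frac (λ N j t → const (γ j) t + shiftUp (T N j) t) frac-zero frac-suc g g-zero
      λ N j tail m m<1+N → begin
        g j (suc m) + ((λ t → const (γ j) t + shiftUp (T N j) t) ⊛ g (suc j)) m
          ≈⟨ +-congˡ (⊛-distribʳ (g (suc j)) (const (γ j)) (shiftUp (T N j)) m) ⟩
        g j (suc m) + ((const (γ j) ⊛ g (suc j)) m + (shiftUp (T N j) ⊛ g (suc j)) m)
          ≈⟨ +-congˡ (+-cong (const-⊛ (γ j) (g (suc j)) m)
               (trans (shiftUp-⊛ (T N j) (g (suc j)) m) (T-⊛ N j tail m m<1+N))) ⟩
        g j (suc m) + (γ j * g (suc j) m + δ j * shiftUp (g (suc (suc j))) m)
          ≈⟨ g-suc j m ⟩
        g (suc j) (suc m)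
          ∎
    where
    T : ℕ → ℕ → Series
    T N j = const (δ j) ⊛ frac N (suc j)
    T-⊛ : ∀ N j → frac N (suc j) ⊛ g (suc j) ≈[ suc N ] g (suc (suc j)) →
      (λ m → shiftUp (T N j ⊛ g (suc j)) m) ≈[ suc N ] (λ m → δ j * shiftUp (g (suc (suc j))) m)
    T-⊛ N j tail zero _ = trans (shiftUp-zero _) (sym (trans (*-congˡ (shiftUp-zero _)) (zeroʳ _)))
    T-⊛ N j tail (suc m) 1+m<1+N = begin
      shiftUp (T N j ⊛ g (suc j)) (suc m)
        ≈⟨ shiftUp-suc _ m ⟩
      (T N j ⊛ g (suc j)) m
        ≈⟨ ⊛-assoc (const (δ j)) (frac N (suc j)) (g (suc j)) m ⟩
      (const (δ j) ⊛ (frac N (suc j) ⊛ g (suc j))) m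
        ≈⟨ const-⊛ (δ j) (frac N (suc j) ⊛ g (suc j)) m ⟩
      δ j * (frac N (suc j) ⊛ g (suc j)) m
        ≈⟨ *-congˡ (tail m (ℕₚ.<-trans (ℕₚ.n<1+n m) 1+m<1+N)) ⟩
      δ j * g (suc (suc j)) m
        ≈⟨ *-congˡ (shiftUp-suc _ m) ⟨
      δ j * shiftUp (g (suc (suc j))) (suc m)
        ∎

-- Coefficients of the products in the defining series

module SeriesProducts (R : CommutativeRing 0ℓ 0ℓ) (S : Summation R) (U : UnitSeries R)
    (O : SeriesOperations R S U) where

  open CommutativeRing R hiding (zero)
  open UnitSeries U
  open PowerSeries R S U
  open SeriesOperations O
  open SeriesInverse R S U O
  open import Relation.Binary.Reasoning.Setoid setoid
  open import Algebra.Solver.Ring.NaturalCoefficients.Default (CommutativeRing.commutativeSemiring seriesRing)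
    renaming (solve to solveₛ)

  module _ (A B Z : Series) (Z≈ : ∀ m → Z m ≈ shiftUp 𝟙 m) (x κ : Carrier) where

    -- For A = z^n and B the product of the first n factors, `extended` unfolds to the term with
    -- index n + 1 of the defining series, the new factor being x / (1 - κz).
    I extended : Series
    I = inv (const κ)
    extended = (A ⊛ Z) ⊛ (B ⊛ (const x ⊛ I))

    extended-inv : ∀ m → extended m ≈ (I ⊛ (const x ⊛ (Z ⊛ (A ⊛ B)))) m
    extended-inv m = solveₛ 5 (λ A B Z c I → (A :* Z) :* (B :* (c :* I)) := I :* (c :* (Z :* (A :* B))))
      (CommutativeRing.refl seriesRing) A B Z (const x) I .at m

    scaled : ∀ m → (const x ⊛ (Z ⊛ (A ⊛ B))) m ≈ x * shiftUp (A ⊛ B) m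
    scaled m = begin
      (const x ⊛ (Z ⊛ (A ⊛ B))) m       ≈⟨ const-⊛ x (Z ⊛ (A ⊛ B)) m ⟩
      x * (Z ⊛ (A ⊛ B)) m               ≈⟨ *-congˡ (⊛-cong {Z} {shiftUp 𝟙} {A ⊛ B} {A ⊛ B} (ptwise Z≈) (ptwise λ _ → refl) .at m) ⟩
      x * (shiftUp 𝟙 ⊛ (A ⊛ B)) m       ≈⟨ *-congˡ (shiftUp-⊛ 𝟙 (A ⊛ B) m) ⟩
      x * shiftUp (𝟙 ⊛ (A ⊛ B)) m       ≈⟨ *-congˡ (shiftUp-cong (⊛-identityˡ (A ⊛ B)) m) ⟩
      x * shiftUp (A ⊛ B) m             ∎

    -- The relation F / (1 - κz) = F + κz F / (1 - κz), with F equal to xz times the previous term.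
    extended-unfold : ∀ m → extended m ≈ x * shiftUp (A ⊛ B) m + shiftUp (λ t → κ * extended t) m
    extended-unfold m = begin
      extended m
        ≈⟨ extended-inv m ⟩
      (I ⊛ F) m
        ≈⟨ inv-⊛ (const κ) F m ⟩
      F m + shiftUp (I ⊛ (const κ ⊛ F)) m
        ≈⟨ +-cong (scaled m) (shiftUp-cong (λ t → begin
             (I ⊛ (const κ ⊛ F)) t
               ≈⟨ solveₛ 3 (λ I k F → I :* (k :* F) := k :* (I :* F))
                    (CommutativeRing.refl seriesRing) I (const κ) F .at t ⟩
             (const κ ⊛ (I ⊛ F)) t
               ≈⟨ const-⊛ κ (I ⊛ F) t ⟩
             κ * (I ⊛ F) t
               ≈⟨ *-congˡ (extended-inv t) ⟨
             κ * extended t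
               ∎) m) ⟩
      x * shiftUp (A ⊛ B) m + shiftUp (λ t → κ * extended t) m
        ∎
      where
      F = const x ⊛ (Z ⊛ (A ⊛ B))

    extended-zero : extended 0 ≈ 0#
    extended-zero = trans (extended-unfold 0)
      (trans (+-cong (trans (*-congˡ (shiftUp-zero (A ⊛ B))) (zeroʳ x)) (shiftUp-zero _)) (+-identityˡ 0#))

    extended-suc : ∀ m → extended (suc m) ≈ x * (A ⊛ B) m + κ * extended m
    extended-suc m = trans (extended-unfold (suc m))
      (+-cong (*-congˡ (shiftUp-suc (A ⊛ B) m)) (shiftUp-suc (λ t → κ * extended t) m))

-- Unlike `2 * k`, this reduces to two successors at each step, so induction on k moves two levels
-- of the fraction.
double : ℕ → ℕ
double zero    = zero
double (suc k) = suc (suc (double k))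

-- Columns of the tableau as power series

module TableauSeries (R : CommutativeRing 0ℓ 0ℓ) (S : Summation R) (U : UnitSeries R)
    (O : SeriesOperations R S U) (e o : ℕ → CommutativeRing.Carrier R) where

  open CommutativeRing R hiding (zero)
  open UnitSeries U
  open PowerSeries R S U using (Series)
  open SeriesOperations O
  open StieltjesTableau R e o
  open import Algebra.Solver.Ring.NaturalCoefficients.Default commutativeSemiring
  open import Relation.Binary.Reasoning.Setoid setoid

  +*0 : ∀ {x y z} → z ≈ 0# → x + y * z ≈ x
  +*0 z≈0 = trans (+-congˡ (trans (*-congˡ z≈0) (zeroʳ _))) (+-identityʳ _)

  L′-diagonal : ∀ n → L′ n n ≈ L n n
  L′-diagonal n = +*0 (L-upper n (suc n) ℕₚ.≤-refl)

  L-diagonal : ∀ n → L n n ≈ 1#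
  L-diagonal zero = refl
  L-diagonal (suc n) = begin
    L′ n n + e (suc n) * L′ n (suc n)   ≈⟨ +*0 (trans (+*0 (L-upper n _ (ℕₚ.m≤n⇒m≤1+n ℕₚ.≤-refl))) (L-upper n _ ℕₚ.≤-refl)) ⟩
    L′ n n                              ≈⟨ L′-diagonal n ⟩
    L n n                               ≈⟨ L-diagonal n ⟩
    1#                                  ∎

  -- A column's generating function divided by z^k, which makes the unit diagonal its constant term.
  -- The index is raised by one to leave room for Euler's initial series g₀ = 1.
  jacobiColumn : ℕ → Series
  jacobiColumn zero    = 𝟙
  jacobiColumn (suc k) n = L (n ℕ.+ k) k

  jacobiColumn-zero : ∀ k → jacobiColumn k 0 ≈ 1#
  jacobiColumn-zero zero    = 𝟙-zero
  jacobiColumn-zero (suc k) = L-diagonal k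

  module _ (γ δ : ℕ → Carrier)
      (γ-zero : γ 0 ≈ e 0) (γ-suc : ∀ k → γ (suc k) ≈ o k + e (suc k)) (δ≈ : ∀ k → δ k ≈ e k * o k) where

    shiftUp-jacobiColumn : ∀ k n → shiftUp (jacobiColumn (suc (suc k))) n ≈ L (n ℕ.+ k) (suc k)
    shiftUp-jacobiColumn k zero    = trans (shiftUp-zero _) (sym (L-upper k (suc k) ℕₚ.≤-refl))
    shiftUp-jacobiColumn k (suc n) = trans (shiftUp-suc _ n)
      (reflexive (≡.cong (λ i → L i (suc k)) (ℕₚ.+-suc n k)))

    -- Eliminating `L′` from the tableau removes the odd heights; this is the even contraction of
    -- the S-fraction to the J-fraction.
    jacobiColumn-suc : ∀ k n →
      jacobiColumn k (suc n) + (γ k * jacobiColumn (suc k) n + δ k * shiftUp (jacobiColumn (suc (suc k))) n)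
      ≈ jacobiColumn (suc k) (suc n)
    jacobiColumn-suc zero n = begin
      𝟙 (suc n) + (γ 0 * x + δ 0 * _)
        ≈⟨ +-cong (𝟙-suc n) (+-cong (*-congʳ γ-zero) (*-cong (δ≈ 0) (shiftUp-jacobiColumn 0 n))) ⟩
      0# + (e 0 * x + e 0 * o 0 * w)
        ≈⟨ solve 4 (λ e o x w → con 0 :+ (e :* x :+ e :* o :* w) := e :* (x :+ o :* w)) refl (e 0) (o 0) x w ⟩
      e 0 * (x + o 0 * w)
        ∎
      where
      x = L (n ℕ.+ 0) 0
      w = L (n ℕ.+ 0) 1
    jacobiColumn-suc (suc k) n = begin
      L (suc n ℕ.+ k) k + (γ (suc k) * x + δ (suc k) * _)
        ≈⟨ +-cong (reflexive (≡.cong (λ i → L i k) (≡.sym (ℕₚ.+-suc n k))))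
             (+-cong (*-congʳ (γ-suc k)) (*-cong (δ≈ (suc k)) (shiftUp-jacobiColumn (suc k) n))) ⟩
      y + ((o k + e (suc k)) * x + e (suc k) * o (suc k) * w)
        ≈⟨ solve 6 (λ e o o′ y x w → y :+ ((o :+ e) :* x :+ e :* o′ :* w) := (y :+ o :* x) :+ e :* (x :+ o′ :* w))
             refl (e (suc k)) (o k) (o (suc k)) y x w ⟩
      (y + o k * x) + e (suc k) * (x + o (suc k) * w)
        ∎
      where
      y = L (n ℕ.+ suc k) k
      x = L (n ℕ.+ suc k) (suc k)
      w = L (n ℕ.+ suc k) (suc (suc k))

  module _ (α : ℕ → Carrier)
      (α-even : ∀ k → α (double k) ≈ e k) (α-odd : ∀ k → α (suc (double k)) ≈ o k) where

    -- the tableau along both parities: L (n + k) k and L′ (n + k) k for the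
    -- heights j = 2k and j = 2k + 1
    stieltjesTableau : ℕ → ℕ → Carrier
    stieltjesTableau zero    j       = 1#
    stieltjesTableau (suc n) zero    = α 0 * stieltjesTableau n 1
    stieltjesTableau (suc n) (suc j) =
      stieltjesTableau (suc n) j + α (suc j) * stieltjesTableau n (suc (suc j))

    mutual
      tableau-even : ∀ n k → L (n ℕ.+ k) k ≈ stieltjesTableau n (double k)
      tableau-even zero    k       = L-diagonal k
      tableau-even (suc n) zero    = *-cong (sym (α-even 0)) (tableau-odd n 0)
      tableau-even (suc n) (suc k) = +-cong
        (trans (reflexive (≡.cong (λ i → L′ i k) (ℕₚ.+-suc n k))) (tableau-odd (suc n) k))
        (*-cong (sym (α-even (suc k))) (tableau-odd n (suc k)))

      tableau-odd : ∀ n k → L′ (n ℕ.+ k) k ≈ stieltjesTableau n (suc (double k))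
      tableau-odd zero    k = trans (L′-diagonal k) (L-diagonal k)
      tableau-odd (suc n) k = +-cong (tableau-even (suc n) k)
        (*-cong (sym (α-odd k))
          (trans (reflexive (≡.cong (λ i → L i (suc k)) (≡.sym (ℕₚ.+-suc n k)))) (tableau-even n (suc k))))

    stieltjesColumn : ℕ → Series
    stieltjesColumn zero    = 𝟙
    stieltjesColumn (suc j) n = stieltjesTableau n j

    stieltjesColumn-zero : ∀ j → stieltjesColumn j 0 ≈ 1#
    stieltjesColumn-zero zero    = 𝟙-zero
    stieltjesColumn-zero (suc j) = refl

    stieltjesColumn-suc : ∀ j n →
      stieltjesColumn j (suc n) + α j * stieltjesColumn (suc (suc j)) n ≈ stieltjesColumn (suc j) (suc n)
    stieltjesColumn-suc zero    n = trans (+-congʳ (𝟙-suc n)) (+-identityˡ _)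
    stieltjesColumn-suc (suc j) n = refl

-- The rings of polynomials and of series in z

open import Defs

ℤ-sum : Summation ℤₚ.+-*-commutativeRing
ℤ-sum = record { Σ = sumTo ; Σ-zero = λ _ → ≡.refl ; Σ-suc = λ _ _ → ≡.refl }

ℤ-unit : UnitSeries ℤₚ.+-*-commutativeRing
ℤ-unit = record { 𝟙 = 1P 0 0 ; 𝟙-zero = ≡.refl ; 𝟙-suc = λ _ → ≡.refl }

module P₁ = PowerSeries ℤₚ.+-*-commutativeRing ℤ-sum ℤ-unit

P₁-sum : Summation P₁.seriesRing
P₁-sum = record
  { Σ = λ n f l → sumTo n λ t → f t l
  ; Σ-zero = λ _ → P₁.ptwise λ _ → ≡.refl
  ; Σ-suc = λ _ _ → P₁.ptwise λ _ → ≡.refl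
  }

P₁-unit : UnitSeries P₁.seriesRing
P₁-unit = record
  { 𝟙 = 1P 0
  ; 𝟙-zero = P₁.ptwise λ _ → ≡.refl
  ; 𝟙-suc = λ _ → P₁.ptwise λ _ → ≡.refl
  }

module P₂ = PowerSeries P₁.seriesRing P₁-sum P₁-unit

P₂-sum : Summation P₂.seriesRing
P₂-sum = record
  { Σ = λ n f j l → sumTo n λ t → f t j l
  ; Σ-zero = λ _ → P₂.ptwise λ _ → P₁.ptwise λ _ → ≡.refl
  ; Σ-suc = λ _ _ → P₂.ptwise λ _ → P₁.ptwise λ _ → ≡.refl
  }

P₂-unit : UnitSeries P₂.seriesRing
P₂-unit = record
  { 𝟙 = 1P
  ; 𝟙-zero = P₂.ptwise λ _ → P₁.ptwise λ _ → ≡.refl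
  ; 𝟙-suc = λ _ → P₂.ptwise λ _ → P₁.ptwise λ _ → ≡.refl
  }

module P₃ = PowerSeries P₂.seriesRing P₂-sum P₂-unit

polyRing : CommutativeRing 0ℓ 0ℓ
polyRing = P₃.seriesRing

infix 4 _≋P_
_≋P_ : P → P → Set
_≋P_ = P₃._≋_

fromPtwise : ∀ {f g} → f ≈P g → f ≋P g
fromPtwise p = P₃.ptwise λ i → P₂.ptwise λ j → P₁.ptwise λ l → p i j l

toPtwise : ∀ {f g} → f ≋P g → f ≈P g
toPtwise p i j l = P₁.at (P₂.at (P₃.at p i) j) l

poly-sum : Summation polyRing
poly-sum = record
  { Σ = sumP
  ; Σ-zero = λ _ → fromPtwise λ _ _ _ → ≡.refl
  ; Σ-suc = λ _ _ → fromPtwise λ _ _ _ → ≡.refl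
  }

poly-unit : UnitSeries polyRing
poly-unit = record
  { 𝟙 = 1S
  ; 𝟙-zero = fromPtwise λ _ _ _ → ≡.refl
  ; 𝟙-suc = λ _ → fromPtwise λ _ _ _ → ≡.refl
  }

module PowSer = PowerSeries polyRing poly-sum poly-unit

module ℤΣ = FiniteSums ℤₚ.+-*-commutativeRing ℤ-sum

poly-operations : SeriesOperations polyRing poly-sum poly-unit
poly-operations = record
  { shiftUp = zTimes
  ; shiftUp-zero = λ _ → fromPtwise λ _ _ _ → ≡.refl
  ; shiftUp-suc = λ _ _ → fromPtwise λ _ _ _ → ≡.refl
  ; const = constS
  ; const-zero = λ _ → fromPtwise λ _ _ _ → ≡.refl
  ; const-suc = λ _ _ → fromPtwise λ _ _ _ → ≡.refl
  ; pow = powS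
  ; pow-zero = λ _ _ → fromPtwise λ _ _ _ → ≡.refl
  ; pow-suc = λ _ _ _ → fromPtwise λ _ _ _ → ≡.refl
  ; inv = invOneMinusZ
  ; inv-def = λ _ _ → fromPtwise λ _ _ _ → ≡.refl
  }

·P-*P : ∀ k f g → ((k ·P f) *P g) ≈P (k ·P (f *P g))
·P-*P k f g i j l = begin
  ((k ·P f) *P g) i j l
    ≡⟨ ℤΣ.Σ-cong i (λ t → ℤΣ.Σ-cong j λ u → ℤΣ.Σ-cong l λ v → ℤₚ.*-assoc k (f t u v) _) ⟩
  sumTo i (λ t → sumTo j (λ u → sumTo l (λ v → k ℤ.* (f t u v ℤ.* g (i ∸ t) (j ∸ u) (l ∸ v)))))
    ≡⟨ ℤΣ.Σ-cong i (λ t → ℤΣ.Σ-cong j λ u → ℤΣ.Σ-*ˡ l k _) ⟩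
  sumTo i (λ t → sumTo j (λ u → k ℤ.* sumTo l (λ v → f t u v ℤ.* g (i ∸ t) (j ∸ u) (l ∸ v))))
    ≡⟨ ℤΣ.Σ-cong i (λ t → ℤΣ.Σ-*ˡ j k _) ⟩
  sumTo i (λ t → k ℤ.* sumTo j (λ u → sumTo l (λ v → f t u v ℤ.* g (i ∸ t) (j ∸ u) (l ∸ v))))
    ≡⟨ ℤΣ.Σ-*ˡ i k _ ⟩
  (k ·P (f *P g)) i j l
    ∎
  where open ≡.≡-Reasoning

poly-ℤ-scalars : ℤ-scalars polyRing
poly-ℤ-scalars = record
  { ⟦_⟧ = λ k → k ·P 1P
  ; +-homo = λ k l → fromPtwise λ i j m → ℤₚ.*-distribʳ-+ (1P i j m) k l
  ; *-homo = λ k l → fromPtwise λ i j m → ≡.trans (ℤₚ.*-assoc k l (1P i j m))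
      (≡.sym (≡.trans (·P-*P k 1P (l ·P 1P) i j m)
        (≡.cong (k ℤ.*_) (toPtwise (CommutativeRing.*-identityˡ polyRing (l ·P 1P)) i j m))))
  ; -‿homo = λ k → fromPtwise λ i j m → ≡.sym (ℤₚ.neg-distribˡ-* k (1P i j m))
  ; 0-homo = fromPtwise λ _ _ _ → ≡.refl
  ; 1-homo = fromPtwise λ i j m → ℤₚ.*-identityˡ (1P i j m)
  }

poly-scalars : Scalars polyRing
poly-scalars = record
  { ν = natP
  ; ν-zero = fromPtwise λ _ _ _ → ≡.refl
  ; ν-suc = λ n → fromPtwise λ i j l → ℤₚ.suc-* (+ n) (1P i j l)
  }

-- Polynomials with nonnegative coefficients

sumTo-nonneg : ∀ n f → (∀ t → 0ℤ ℤ.≤ f t) → 0ℤ ℤ.≤ sumTo n f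
sumTo-nonneg zero    f f≥0 = f≥0 0
sumTo-nonneg (suc n) f f≥0 = ℤₚ.+-mono-≤ (sumTo-nonneg n f f≥0) (f≥0 (suc n))

*-nonneg : ∀ {x y} → 0ℤ ℤ.≤ x → 0ℤ ℤ.≤ y → 0ℤ ℤ.≤ x ℤ.* y
*-nonneg {+ m} {+ n} _ _ = ≡.subst (0ℤ ℤ.≤_) (ℤₚ.pos-* m n) (ℤ.+≤+ z≤n)

split-degree : ∀ i j l {t u v} → t ℕ.≤ i → u ℕ.≤ j → v ℕ.≤ l →
  (t ℕ.+ u ℕ.+ v) ℕ.+ ((i ∸ t) ℕ.+ (j ∸ u) ℕ.+ (l ∸ v)) ≡ i ℕ.+ j ℕ.+ l
split-degree i j l {t} {u} {v} t≤i u≤j v≤l = ≡.trans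
  (solve 6 (λ t u v t′ u′ v′ → (t :+ u :+ v) :+ (t′ :+ u′ :+ v′) := (t :+ t′) :+ (u :+ u′) :+ (v :+ v′))
    ≡.refl t u v (i ∸ t) (j ∸ u) (l ∸ v))
  (≡.cong₂ ℕ._+_ (≡.cong₂ ℕ._+_ (ℕₚ.m+[n∸m]≡n t≤i) (ℕₚ.m+[n∸m]≡n u≤j)) (ℕₚ.m+[n∸m]≡n v≤l))
  where open +-*-Solver

PolyNonneg-* : ∀ {f g} → PolyNonneg f → PolyNonneg g → PolyNonneg (f *P g)
PolyNonneg-* {f} {g} ((D , f-supp) , f≥0) ((E , g-supp) , g≥0) = (D ℕ.+ E , supp) , λ i j l →
  sumTo-nonneg i _ λ t → sumTo-nonneg j _ λ u → sumTo-nonneg l _ λ v →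
    *-nonneg (f≥0 t u v) (g≥0 (i ∸ t) (j ∸ u) (l ∸ v))
  where
  supp : ∀ i j l → D ℕ.+ E ℕ.< i ℕ.+ j ℕ.+ l → (f *P g) i j l ≡ 0ℤ
  supp i j l D+E<deg = ℤΣ.Σ-0 i λ t t≤i → ℤΣ.Σ-0 j λ u u≤j → ℤΣ.Σ-0 l λ v v≤l → term t u v t≤i u≤j v≤l
    where
    term : ∀ t u v → t ℕ.≤ i → u ℕ.≤ j → v ℕ.≤ l → f t u v ℤ.* g (i ∸ t) (j ∸ u) (l ∸ v) ≡ 0ℤ
    term t u v t≤i u≤j v≤l with D ℕ.<? t ℕ.+ u ℕ.+ v
    ... | yes D< = ≡.cong (ℤ._* g (i ∸ t) (j ∸ u) (l ∸ v)) (f-supp t u v D<)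
    -- The degrees of the two factors add up to more than D + E, so if the first is at most D, the
    -- second exceeds E.
    ... | no D≮ = ≡.trans
      (≡.cong (f t u v ℤ.*_) (g-supp (i ∸ t) (j ∸ u) (l ∸ v) (ℕₚ.+-cancelˡ-< D _ _
        (ℕₚ.<-≤-trans D+E<deg (ℕₚ.≤-trans (ℕₚ.≤-reflexive (≡.sym (split-degree i j l t≤i u≤j v≤l)))
          (ℕₚ.+-monoˡ-≤ _ (ℕₚ.≮⇒≥ D≮)))))))
      (ℤₚ.*-zeroʳ (f t u v))

PolyNonneg-+ : ∀ {f g} → PolyNonneg f → PolyNonneg g → PolyNonneg (f +P g)
PolyNonneg-+ ((D , f-supp) , f≥0) ((E , g-supp) , g≥0) =
  (D ℕ.⊔ E , λ i j l D⊔E< → ≡.cong₂ ℤ._+_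
    (f-supp i j l (ℕₚ.≤-<-trans (ℕₚ.m≤m⊔n D E) D⊔E<))
    (g-supp i j l (ℕₚ.≤-<-trans (ℕₚ.m≤n⊔m D E) D⊔E<)))
  , λ i j l → ℤₚ.+-mono-≤ (f≥0 i j l) (g≥0 i j l)

PolyNonneg-resp : ∀ {f g} → f ≈P g → PolyNonneg f → PolyNonneg g
PolyNonneg-resp f≈g ((D , f-supp) , f≥0) =
  (D , λ i j l D< → ≡.trans (≡.sym (f≈g i j l)) (f-supp i j l D<))
  , λ i j l → ≡.subst (0ℤ ℤ.≤_) (f≈g i j l) (f≥0 i j l)

PolyNonneg-0 : PolyNonneg 0P
PolyNonneg-0 = (0 , λ _ _ _ _ → ≡.refl) , λ _ _ _ → ℤ.+≤+ z≤n

PolyNonneg-1 : PolyNonneg 1P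
PolyNonneg-1 = (0 , λ { zero zero zero () ; zero zero (suc l) _ → ≡.refl ; zero (suc j) l _ → ≡.refl
                      ; (suc i) j l _ → ≡.refl })
  , λ { zero zero zero → ℤ.+≤+ z≤n ; zero zero (suc l) → ℤ.+≤+ z≤n ; zero (suc j) l → ℤ.+≤+ z≤n
      ; (suc i) j l → ℤ.+≤+ z≤n }

PolyNonneg-varA : PolyNonneg varA
PolyNonneg-varA =
  (1 , λ { zero j l _ → ≡.refl ; (suc zero) zero zero (s≤s ()) ; (suc zero) zero (suc l) _ → ≡.refl
         ; (suc zero) (suc j) l _ → ≡.refl ; (suc (suc i)) j l _ → ≡.refl })
  , λ { zero j l → ℤ.+≤+ z≤n ; (suc zero) zero zero → ℤ.+≤+ z≤n ; (suc zero) zero (suc l) → ℤ.+≤+ z≤n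
      ; (suc zero) (suc j) l → ℤ.+≤+ z≤n ; (suc (suc i)) j l → ℤ.+≤+ z≤n }

PolyNonneg-varB : PolyNonneg varB
PolyNonneg-varB =
  (1 , λ { (suc i) j l _ → ≡.refl ; zero zero l _ → ≡.refl ; zero (suc zero) zero (s≤s ())
         ; zero (suc zero) (suc l) _ → ≡.refl ; zero (suc (suc j)) l _ → ≡.refl })
  , λ { (suc i) j l → ℤ.+≤+ z≤n ; zero zero l → ℤ.+≤+ z≤n ; zero (suc zero) zero → ℤ.+≤+ z≤n
      ; zero (suc zero) (suc l) → ℤ.+≤+ z≤n ; zero (suc (suc j)) l → ℤ.+≤+ z≤n }

PolyNonneg-varC : PolyNonneg varC
PolyNonneg-varC =
  (1 , λ { (suc i) j l _ → ≡.refl ; zero (suc j) l _ → ≡.refl ; zero zero zero _ → ≡.refl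
         ; zero zero (suc zero) (s≤s ()) ; zero zero (suc (suc l)) _ → ≡.refl })
  , λ { (suc i) j l → ℤ.+≤+ z≤n ; zero (suc j) l → ℤ.+≤+ z≤n ; zero zero zero → ℤ.+≤+ z≤n
      ; zero zero (suc zero) → ℤ.+≤+ z≤n ; zero zero (suc (suc l)) → ℤ.+≤+ z≤n }

PolyNonneg-natP : ∀ n → PolyNonneg (natP n)
PolyNonneg-natP n = (0 , λ i j l 0<deg → ≡.trans (≡.cong (+ n ℤ.*_) (proj₂ (proj₁ PolyNonneg-1) i j l 0<deg)) (ℤₚ.*-zeroʳ (+ n)))
  , λ i j l → *-nonneg {+ n} (ℤ.+≤+ z≤n) (proj₂ PolyNonneg-1 i j l)

poly-positivity : Positivity polyRing
poly-positivity = record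
  { Pos = PolyNonneg
  ; Pos-resp = λ f≋g → PolyNonneg-resp (toPtwise f≋g)
  ; Pos-0 = PolyNonneg-0
  ; Pos-1 = PolyNonneg-1
  ; Pos-+ = PolyNonneg-+
  ; Pos-* = PolyNonneg-*
  }

-- The weights α by parity

double%2 : ∀ n → double n % 2 ≡ 0
double%2 zero    = ≡.refl
double%2 (suc n) = double%2 n

1+double%2 : ∀ n → suc (double n) % 2 ≡ 1
1+double%2 zero    = ≡.refl
1+double%2 (suc n) = 1+double%2 n

double/2 : ∀ n → double n / 2 ≡ n
double/2 zero    = ≡.refl
double/2 (suc n) = ≡.trans (m/n≡1+[m∸n]/n {double (suc n)} {2} (s≤s (s≤s z≤n))) (≡.cong suc (double/2 n))

1+double/2 : ∀ n → suc (double n) / 2 ≡ n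
1+double/2 zero    = ≡.refl
1+double/2 (suc n) = ≡.trans (m/n≡1+[m∸n]/n {suc (double (suc n))} {2} (s≤s (s≤s z≤n))) (≡.cong suc (1+double/2 n))

double≡2* : ∀ n → 2 ℕ.* n ≡ double n
double≡2* zero    = ≡.refl
double≡2* (suc n) = ≡.cong suc (≡.trans (ℕₚ.+-suc n (n ℕ.+ 0)) (≡.cong suc (double≡2* n)))

open Moments polyRing poly-scalars varA varB varC

alpha-even : ∀ n → alpha (double n) ≡ e n
alpha-even n rewrite double%2 n | double/2 n = ≡.refl

alpha-odd : ∀ n → alpha (suc (double n)) ≡ o n
alpha-odd n rewrite 1+double%2 n | 1+double/2 n = ≡.refl

-- Determinants, moments and fractions over the polynomial ring

module Poly = CommutativeRing polyRing
module PolyDet = Determinants polyRing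

open StieltjesTableau polyRing e o using (L; module HankelMinors)

sumFinP-neg : ∀ k (s : Fin k → ℤ) (f : Fin k → P) →
  sumFinP k (λ j → (ℤ.- s j) ·P f j) ≈P (-P sumFinP k (λ j → s j ·P f j))
sumFinP-neg zero    s f i j l = ≡.refl
sumFinP-neg (suc k) s f i j l = ≡.trans
  (≡.cong₂ ℤ._+_ (≡.sym (ℤₚ.neg-distribˡ-* (s zero) (f zero i j l)))
                 (sumFinP-neg k (λ r → s (suc r)) (λ r → f (suc r)) i j l))
  (≡.sym (ℤₚ.neg-distrib-+ (s zero ℤ.* f zero i j l) _))

-- Each unfolding of `sign` contributes one minus to the whole remaining sum, which is the nested
-- subtraction of `altSum`.
sumFinP-sign : ∀ k f → sumFinP k (λ j → sign (toℕ j) ·P f j) ≋P PolyDet.altSum k f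
sumFinP-sign zero    f = Poly.refl
sumFinP-sign (suc k) f = Poly.+-cong
  {1ℤ ·P f zero} {f zero} {sumFinP k (λ j → (ℤ.- sign (toℕ j)) ·P f (suc j))}
  (fromPtwise λ i j l → ℤₚ.*-identityˡ (f zero i j l))
  (Poly.trans
    (fromPtwise (sumFinP-neg k (λ j → sign (toℕ j)) (λ j → f (suc j))))
    (Poly.-‿cong (sumFinP-sign k (λ j → f (suc j)))))

det-cofactor : ∀ k M → det k M ≋P PolyDet.det k M
det-cofactor zero    M = Poly.refl
det-cofactor (suc k) M = Poly.trans
  (sumFinP-sign (suc k) (λ j → M zero j *P det k (PolyDet.minor M j)))
  (PolyDet.altSum-cong (suc k) λ j →
    Poly.*-cong {M zero j} Poly.refl (det-cofactor k (PolyDet.minor M j)))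

module PolySeries = SeriesProducts polyRing poly-sum poly-unit poly-operations

zS-shift : ∀ m → zS m ≋P zTimes 1S m
zS-shift zero          = Poly.refl
zS-shift (suc zero)    = Poly.refl
zS-shift (suc (suc m)) = Poly.refl

-- A weighted form of the classical expansion of z^n / ((1 - z)(1 - 2z)⋯(1 - nz)) by Stirling
-- numbers. The factor `X n 0` collects the numerators a + k b.
GTerm-coefficient : ∀ n m → GTerm n m ≋P stirling m n *P X n 0
GTerm-coefficient zero m = Poly.trans (PowSer.⊛-identityˡ 1S m) (unit m)
  where
  unit : ∀ m → 1S m ≋P stirling m 0 *P 1P
  unit zero    = Poly.sym (Poly.*-identityʳ 1P)
  unit (suc m) = Poly.sym (Poly.*-identityʳ 0P)
GTerm-coefficient (suc n) zero = Poly.trans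
  (PolySeries.extended-zero (powS zS n) (prodS n GFactor) zS zS-shift (e n) (natP (suc n) *P varC))
  (Poly.sym (Poly.zeroˡ (X (suc n) 0)))
GTerm-coefficient (suc n) (suc m) = Poly.trans
  (PolySeries.extended-suc (powS zS n) (prodS n GFactor) zS zS-shift (e n) (natP (suc n) *P varC) m)
  (Poly.trans
    (Poly.+-cong
      (Poly.*-cong {e n} Poly.refl (GTerm-coefficient n m))
      (Poly.*-cong {natP (suc n) *P varC} Poly.refl (GTerm-coefficient (suc n) m)))
    (stirling-X-suc m n))

module PolyΣ = FiniteSums polyRing poly-sum

GSeries-moment : ∀ m → GSeries m ≋P L m 0
GSeries-moment m = Poly.trans
  -- The separate summand `1S` is the term n = 0, so the sum runs over all n ≤ m + 1, which covers
  -- every n with a nonzero coefficient at z^m.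
  (Poly.+-cong {1S m} {GTerm 0 m} (Poly.sym (PowSer.⊛-identityˡ 1S m)) Poly.refl)
  (Poly.trans
    (Poly.sym (PolyΣ.Σ-head m (λ n → GTerm n m)))
    (Poly.trans
      (PolyΣ.Σ-cong (suc m) (λ n → GTerm-coefficient n m))
      (Σ-stirling-X poly-sum m (suc m) (ℕₚ.n≤1+n m))))

module PolyFractions = ContinuedFractions polyRing poly-sum poly-unit poly-operations
module PolyTableau = TableauSeries polyRing poly-sum poly-unit poly-operations e o

module PolyStieltjes where
  open PolyTableau

  α-even : ∀ k → alpha (double k) ≋P e k
  α-even k = Poly.reflexive (alpha-even k)

  α-odd : ∀ k → alpha (suc (double k)) ≋P o k
  α-odd k = Poly.reflexive (alpha-odd k)

  sfrac-moment : ∀ N m → m ℕ.≤ N → sfrac N 0 m ≋P L m 0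
  sfrac-moment N m m≤N = Poly.trans
    (PolyFractions.sfrac-coefficient sfrac alpha (λ _ _ → Poly.refl) (λ _ _ _ → Poly.refl)
      (stieltjesColumn alpha α-even α-odd)
      (stieltjesColumn-zero alpha α-even α-odd)
      (stieltjesColumn-suc alpha α-even α-odd)
      (λ _ → Poly.refl) N m m≤N)
    (Poly.trans (Poly.sym (tableau-even alpha α-even α-odd m 0))
      (Poly.reflexive (≡.cong (λ n → L n 0) (ℕₚ.+-identityʳ m))))

  jgam-zero : jgam 0 ≋P e 0
  jgam-zero = Poly.trans (Poly.+-identityˡ (alpha 0)) (α-even 0)

  jgam-suc : ∀ k → jgam (suc k) ≋P o k +P e (suc k)
  jgam-suc k = Poly.+-cong {alphaM1 (2 ℕ.* suc k)} {o k} {alpha (2 ℕ.* suc k)}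
    (Poly.trans (Poly.reflexive (≡.cong alphaM1 (double≡2* (suc k)))) (α-odd k))
    (Poly.trans (Poly.reflexive (≡.cong alpha (double≡2* (suc k)))) (α-even (suc k)))

  jdel-product : ∀ k → jdel k ≋P e k *P o k
  jdel-product k = Poly.*-cong {alpha (2 ℕ.* k)} {e k} {alpha (suc (2 ℕ.* k))}
    (Poly.trans (Poly.reflexive (≡.cong alpha (double≡2* k))) (α-even k))
    (Poly.trans (Poly.reflexive (≡.cong (λ n → alpha (suc n)) (double≡2* k))) (α-odd k))

  jfrac-moment : ∀ N m → m ℕ.≤ N → jfrac N 0 m ≋P L m 0
  jfrac-moment N m m≤N = Poly.trans
    (PolyFractions.jfrac-coefficient jfrac jgam jdel (λ _ _ → Poly.refl) (λ _ _ _ → Poly.refl)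
      jacobiColumn jacobiColumn-zero
      (jacobiColumn-suc jgam jdel jgam-zero jgam-suc jdel-product)
      (λ _ → Poly.refl) N m m≤N)
    (Poly.reflexive (≡.cong (λ n → L n 0) (ℕₚ.+-identityʳ m)))

e-nonneg : ∀ k → PolyNonneg (e k)
e-nonneg k = PolyNonneg-+ PolyNonneg-varA (PolyNonneg-* (PolyNonneg-natP k) PolyNonneg-varB)

o-nonneg : ∀ k → PolyNonneg (o k)
o-nonneg k = PolyNonneg-* (PolyNonneg-natP (suc k)) (PolyNonneg-+ PolyNonneg-varC PolyNonneg-varB)

G-minors : ∀ k (r c : Fin k → ℕ) → StrictlyIncreasing r → StrictlyIncreasing c →
  PolyNonneg (PolyDet.det k (λ i j → G (r i ℕ.+ c j)))
G-minors k r c r-inc c-inc = PolyNonneg-resp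
  (toPtwise (PolyDet.det-cong k λ i j → Poly.sym (GSeries-moment (r i ℕ.+ c j))))
  (HankelMinors.Hankel-minors poly-positivity e-nonneg o-nonneg k r c r-inc c-inc)

module PolyLogConvexity = LogConvexity polyRing poly-positivity poly-ℤ-scalars

G-log-convex : Is3xLogConvex G
G-log-convex 1 _ _ = PolyLogConvexity.𝓛≥0 G G-minors
G-log-convex 2 _ _ = PolyLogConvexity.𝓛²≥0 G G-minors
G-log-convex 3 _ _ = PolyLogConvexity.𝓛³≥0 G G-minors
G-log-convex (suc (suc (suc (suc m)))) _ (s≤s (s≤s (s≤s ())))

theorem3p5 : ConvergesTo (λ N → sfrac N 0) GSeries
    × ConvergesTo (λ N → jfrac N 0) GSeries
    × IsxStieltjes G
    × Is3xLogConvex G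
theorem3p5 =
    (λ m → m , λ N m≤N → toPtwise
      (Poly.trans (PolyStieltjes.sfrac-moment N m m≤N) (Poly.sym (GSeries-moment m))))
  , (λ m → m , λ N m≤N → toPtwise
      (Poly.trans (PolyStieltjes.jfrac-moment N m m≤N) (Poly.sym (GSeries-moment m))))
  , (λ k r c r-inc c-inc → PolyNonneg-resp
      (toPtwise (Poly.sym (det-cofactor k (λ i j → G (r i ℕ.+ c j)))))
      (G-minors k r c r-inc c-inc))
  , G-log-convex
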